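{- For every $t$ and $k$ there exists $c$ such that for every $P_t$-free graph $G$ with $\omega(G)\leq k$ and every potential maximal clique $\Omega$ of $G$, one of the following two conditions holds: 1. there exists $v\in \Omega$ such that $\Omega = N[v]$; or 2. there exists a family $\mathcal{D}\subseteq \mathrm{cc}(G-\Omega)$ of size at most $c$ such that $\Omega=\bigcup_{D\in \mathcal{D}} N(D)$.
   Context: All graphs are finite and simple. $P_t$ is the path on $t$ vertices; a graph is $P_t$-free if it has no induced subgraph isomorphic to $P_t$. $\omega(G)$ is the size of a largest clique of $G$. $N[v]$ is the closed neighborhood of $v$; for a vertex set $D$, $N(D)$ is the set of vertices outside $D$ with a neighbor in $D$. $\mathrm{cc}(G-\Omega)$ is the set of connected components (as vertex sets) of $G-\Omega$. A graph is chordal if all its induced cycles have length $3$. A chordal completion of $G$ is a chordal graph $H$ with $V(H)=V(G)$ and $E(G)\subseteq E(H)$; it is minimal if no proper subgraph of $H$ is a chordal completion of $G$. A set $\Omega\subseteq V(G)$ is a potential maximal clique (PMC) of $G$ if there is a minimal chordal completion $H$ of $G$ in which $\Omega$ is a maximal clique. -}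

module Defs where

open import Data.Empty using (⊥-elim)
open import Data.Fin using (Fin; toℕ; _≟_)
open import Data.Fin.Properties using (all?)
open import Data.Fin.Subset using (Subset; _∈_; _∉_; _⊆_; ∣_∣; ⊥)
open import Data.Fin.Subset.Properties using (_∈?_; anySubset?; ∣p∣≤n; ∣⊥∣≡0; ∉⊥)
open import Data.List using (List)
open import Data.List.Relation.Unary.Any using (Any)
open import Data.Nat as ℕ using (ℕ; zero; suc; _≤_; s≤s; s≤s⁻¹)
open import Data.Nat.Properties using (1+n≢n; ≤∧≢⇒<; ≤-reflexive; ≤-trans)
open import Data.Product using (Σ-syntax; ∃-syntax; _×_; _,_; proj₁; proj₂)
open import Data.Sum using (_⊎_; inj₁; inj₂; swap)
open import Function.Bundles using (_⇔_)
open import Function.Definitions using (Injective)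
open import Level using (0ℓ)
open import Relation.Binary using (Rel; Decidable; Symmetric; Irreflexive)
open import Relation.Binary.Construct.Closure.ReflexiveTransitive using (Star)
open import Relation.Binary.PropositionalEquality using (_≡_; _≢_; refl; sym; trans; subst)
open import Relation.Nullary using (¬_; Dec; yes; no; ¬?; _×-dec_; _⊎-dec_; _→-dec_)
open import Relation.Unary using (Pred)

-- Adjacency is decidable, so that the finite graphs behave classically.
record Graph (n : ℕ) : Set₁ where
  field
    Adj    : Rel (Fin n) 0ℓ
    adj?   : Decidable Adj
    symm   : Symmetric Adj
    irrefl : Irreflexive _≡_ Adj

open Graph public

------------------------------------------------------------------------
-- Induced subgraphs, paths, cycles

-- H ⊑ G: some induced subgraph of G is isomorphic to H.
infix 4 _⊑_
_⊑_ : ∀ {m n} → Graph m → Graph n → Set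
_⊑_ {m} {n} H G =
  Σ[ f ∈ (Fin m → Fin n) ] Injective _≡_ _≡_ f × (∀ i j → Adj H i j ⇔ Adj G (f i) (f j))

P : (t : ℕ) → Graph t
P t = record
  { Adj    = λ i j → Next i j ⊎ Next j i
  ; adj?   = λ i j → next? i j ⊎-dec next? j i
  ; symm   = swap
  ; irrefl = λ { refl (inj₁ e) → 1+n≢n e ; refl (inj₂ e) → 1+n≢n e }
  }
  where
  Next : Rel (Fin t) 0ℓ
  Next i j = suc (toℕ i) ≡ toℕ j

  next? : Decidable Next
  next? i j = suc (toℕ i) ℕ.≟ toℕ j

C : (ℓ : ℕ) → 3 ≤ ℓ → Graph ℓ
C ℓ 3≤ℓ = record
  { Adj    = λ i j → Next i j ⊎ Next j i
  ; adj?   = λ i j → next? i j ⊎-dec next? j i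
  ; symm   = swap
  ; irrefl = λ { {i} refl (inj₁ e) → noLoop i e ; {i} refl (inj₂ e) → noLoop i e }
  }
  where
  Next : Rel (Fin ℓ) 0ℓ
  Next i j = (suc (toℕ i) ≡ toℕ j) ⊎ (suc (toℕ i) ≡ ℓ × toℕ j ≡ 0)

  next? : Decidable Next
  next? i j = (suc (toℕ i) ℕ.≟ toℕ j) ⊎-dec ((suc (toℕ i) ℕ.≟ ℓ) ×-dec (toℕ j ℕ.≟ 0))

  noLoop : ∀ i → ¬ Next i i
  noLoop i (inj₁ e) = 1+n≢n e
  noLoop i (inj₂ (e , z)) with subst (3 ≤_) (trans (sym e) (subst (λ x → suc x ≡ 1) (sym z) refl)) 3≤ℓ
  ... | s≤s ()

infix 4 _-free_
_-free_ : ∀ {m n} → Graph m → Graph n → Set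
H -free G = ¬ (H ⊑ G)

------------------------------------------------------------------------
-- Cliques

IsClique : ∀ {n} → Graph n → Subset n → Set
IsClique G S = ∀ u v → u ∈ S → v ∈ S → u ≢ v → Adj G u v

isClique? : ∀ {n} (G : Graph n) (S : Subset n) → Dec (IsClique G S)
isClique? G S = all? λ u → all? λ v →
  (u ∈? S) →-dec ((v ∈? S) →-dec (¬? (u ≟ v) →-dec adj? G u v))

IsMaximalClique : ∀ {n} → Graph n → Subset n → Set
IsMaximalClique G S = IsClique G S × (∀ T → IsClique G T → S ⊆ T → T ⊆ S)

IsLargestClique : ∀ {n} → Graph n → Subset n → Set
IsLargestClique G S = IsClique G S × (∀ T → IsClique G T → ∣ T ∣ ≤ ∣ S ∣)

largestClique : ∀ {n} (G : Graph n) → ∃[ S ] IsLargestClique G S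
largestClique {n} G = search n λ T _ → ∣p∣≤n T
  where
  search : ∀ m → (∀ T → IsClique G T → ∣ T ∣ ≤ m) → ∃[ S ] IsLargestClique G S
  search m bound with anySubset? (λ S → isClique? G S ×-dec (∣ S ∣ ℕ.≟ m))
  ... | yes (S , cl , eq) = S , cl , λ T clT → ≤-trans (bound T clT) (≤-reflexive (sym eq))
  search zero    bound | no ∄ = ⊥-elim (∄ (⊥ , (λ _ _ u∈⊥ → ⊥-elim (∉⊥ u∈⊥)) , ∣⊥∣≡0 n))
  search (suc m) bound | no ∄ = search m λ T clT →
    s≤s⁻¹ (≤∧≢⇒< (bound T clT) λ eq → ∄ (T , clT , eq))

ω : ∀ {n} → Graph n → ℕ
ω G = ∣ proj₁ (largestClique G) ∣

------------------------------------------------------------------------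
-- Chordal completions and potential maximal cliques

Chordal : ∀ {n} → Graph n → Set
Chordal G = ∀ ℓ (3≤ℓ : 3 ≤ ℓ) → C ℓ 3≤ℓ ⊑ G → ℓ ≡ 3

-- Inclusion of edge sets, for graphs on the same vertex set.
infix 4 _⊆ᴱ_ _⊂ᴱ_
_⊆ᴱ_ : ∀ {n} → Graph n → Graph n → Set
G ⊆ᴱ H = ∀ u v → Adj G u v → Adj H u v

_⊂ᴱ_ : ∀ {n} → Graph n → Graph n → Set
G ⊂ᴱ H = G ⊆ᴱ H × ∃[ u ] ∃[ v ] (Adj H u v × ¬ Adj G u v)

IsChordalCompletion : ∀ {n} → Graph n → Graph n → Set
IsChordalCompletion G H = Chordal H × G ⊆ᴱ H

-- A completion of G has the vertex set of G, so the proper subgraphs that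
-- matter are those missing an edge.
IsMinimalChordalCompletion : ∀ {n} → Graph n → Graph n → Set₁
IsMinimalChordalCompletion G H =
  IsChordalCompletion G H × (∀ H′ → H′ ⊂ᴱ H → ¬ IsChordalCompletion G H′)

IsPMC : ∀ {n} → Graph n → Subset n → Set₁
IsPMC G Ω = ∃[ H ] (IsMinimalChordalCompletion G H × IsMaximalClique H Ω)

------------------------------------------------------------------------
-- Neighbourhoods and components

N[_,_] : ∀ {n} → Graph n → Fin n → Pred (Fin n) 0ℓ
N[ G , v ] u = u ≡ v ⊎ Adj G v u

N : ∀ {n} → Graph n → Subset n → Pred (Fin n) 0ℓ
N G D u = u ∉ D × ∃[ v ] (v ∈ D × Adj G v u)

⋃N : ∀ {n} → Graph n → List (Subset n) → Pred (Fin n) 0ℓ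
⋃N G 𝒟 u = Any (λ D → N G D u) 𝒟

-- For vertices x, y outside Ω: a walk from x to y in G - Ω.
Walk-avoiding : ∀ {n} → Graph n → Subset n → Rel (Fin n) 0ℓ
Walk-avoiding G Ω = Star λ u v → u ∉ Ω × v ∉ Ω × Adj G u v

-- D ∈ cc(G - Ω).
IsComponent : ∀ {n} → Graph n → Subset n → Pred (Subset n) 0ℓ
IsComponent G Ω D = ∃[ x ] (x ∉ Ω × (∀ y → y ∈ D ⇔ Walk-avoiding G Ω x y))

{-# OPTIONS --safe #-}

-- Two non-adjacent vertices of Ω lie in N(D) for a common component D: otherwise
-- the completion stays chordal after deleting the edge between them together with
-- all edges that leave some D ∪ N(D).  Hence, unless Ω = N[v], any two non-adjacent
-- vertices of Ω are seen by a common component and every vertex is seen by some component.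
--
-- Covering Ω by boundedly many components then follows Ding, Seymour and Winkler.  If
-- each multiset of vertices has a component that sees a fixed fraction of it,
-- multiplicative weights yield a multiset of components of which every vertex sees
-- a fixed fraction, and an ε-net of it is a bounded cover unless many of its components
-- are shattered.
-- If some multiset has no such component, a random sample from it is scattered, and
-- so is a family read off a shattered set: there are vertices v i and components D i j
-- such that N(D i j) contains v i and v j (if non-adjacent) and no other v l.
-- As ω is bounded, Ramsey makes the v i independent, and the walk
-- v 0, D 0 1, v 1, D 1 2, … contains a long induced path.

module Submission where

open import Defs
open import Data.Nat using (ℕ; _≤_)
open import Data.Fin.Subset using (Subset; _∈_)
open import Data.List using (List; length)
open import Data.List.Relation.Unary.All using (All)
open import Data.Product using (∃-syntax; _×_)
open import Data.Sum using (_⊎_)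
open import Relation.Unary using (_≐_)

open import Data.Bool using (Bool; true; false; not; _∨_)
import Data.Bool as Bool
open import Data.Bool.Properties using (¬-not; ∨-zeroʳ)
open import Data.Empty using (⊥-elim)
open import Data.Fin using (Fin; zero; suc; toℕ; fromℕ; fromℕ<; inject₁; inject≤; punchOut; combine; remQuot; _≟_)
open import Data.Fin.Induction using (<-weakInduction)
open import Data.Fin.Properties using (any?; all?; ¬∀⟶∃¬; punchIn-punchOut; remQuot-combine; toℕ-injective; toℕ-inject₁; toℕ-inject≤; toℕ-fromℕ; toℕ-fromℕ<; toℕ<n)
open import Data.Fin.Subset using (_∉_; _⊆_; ∣_∣; ⊥; ⁅_⁆; _∪_)
open import Data.Fin.Subset.Properties using (_∈?_; ∉⊥; x∈⁅x⁆; x∈⁅y⁆⇒x≡y; x∈p∪q⁻; x∈p∪q⁺; q⊆p∪q; p⊂q⇒∣p∣<∣q∣; ∣p∣≤n)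
open import Data.List as List using ([]; _∷_; _++_; map; filter; filterᵇ; cartesianProductWith; allFin)
open import Data.List.Membership.Propositional as List using ()
open import Data.List.Membership.Propositional.Properties using (∈-allFin; ∈-lookup; ∈-map⁺; ∈-map⁻; ∈-filter⁺; ∈-filter⁻; ∈-++⁺ˡ; ∈-++⁺ʳ)
open import Data.List.Properties using (length-++; length-map; length-tabulate)
open import Data.List.Relation.Binary.Sublist.Propositional using (⊆-refl; ⊆-trans; minimum) renaming (_⊆_ to _⊑ˢ_; _∷_ to _∷ˢ_; _∷ʳ_ to _∷ʳˢ_)
open import Data.List.Relation.Binary.Sublist.Propositional.Properties using (filter-⊆; All-resp-⊆)
open import Data.List.Relation.Unary.All as All using ([]; _∷_)
open import Data.List.Relation.Unary.All.Properties using (all-filter; ¬Any⇒All¬; map⁺)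
open import Data.List.Relation.Unary.AllPairs as AllPairs using (AllPairs; []; _∷_)
import Data.List.Relation.Unary.AllPairs.Properties as AllPairs
open import Data.List.Relation.Unary.Any as Any using (Any; here; there)
import Data.List.Relation.Unary.Any.Properties as Any
open import Data.List.Relation.Unary.Unique.Propositional.Properties using (allFin⁺)
open import Data.Nat as ℕ using (zero; suc; _+_; _*_; _^_; _<_; z≤n; s≤s; s≤s⁻¹; _≤?_; _<?_; NonZero; >-nonZero; >-nonZero⁻¹; pred)
open import Data.Nat.Properties hiding (_≟_)
open import Data.Nat.Tactic.RingSolver using (solve-∀)
open import Data.Product as Product using (Σ-syntax; _,_; proj₁; proj₂)
open import Data.Sum using (inj₁; inj₂; swap; [_,_]; map₂)
open import Data.Vec as Vec using (Vec; []; _∷_; lookup; insertAt)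
open import Data.Vec.Membership.Propositional.Properties using (∈-toList⁺) renaming (∈-lookup to ∈-lookupᵛ)
open import Data.Vec.Properties using (insertAt-lookup; insertAt-punchIn; ≡-dec; map-∘; map-cong; lookup-map; lookup∘tabulate; length-toList)
open import Function using (id; _∘_)
open import Function.Bundles using (_⇔_; mk⇔; Equivalence)
open import Relation.Binary using (tri<; tri≈; tri>)
open import Relation.Binary.Construct.Closure.ReflexiveTransitive as Star using (Star; ε; _◅_; _◅◅_)
open import Relation.Binary.PropositionalEquality using (_≡_; _≢_; refl; sym; trans; cong; cong₂; subst; module ≡-Reasoning)
open import Relation.Nullary using (¬_; Dec; yes; no; does; ¬?; _×-dec_; _⊎-dec_; _→-dec_)
open import Relation.Nullary.Decidable using (dec-true; dec-false)

-- Deleting `uv` alone could create an induced cycle through vertices outside `Ω`, because nothing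
-- is known about how `H` connects different components of `G - Ω`. Once the edges that leave some
-- `D ∪ N(D)` are deleted too, `N(D)` separates `D` from the rest, and it is still a clique unless
-- `D` sees both `u` and `v`.
--
-- The size of `Ω` is unbounded and must not enter the constant. The number `a` of rows affects only
-- the length `4qa` of the multiset of columns, not the fraction `1/(4q)` of it that each row hits,
-- and the net depends only on this fraction and on the dimension `m * m`. Here `m` is a Ramsey
-- bound, and `q = m³ + 1` exceeds the number of triples of sampled vertices.
--
-- Probabilities are kept as counts: probability at most `1/q` reads `q * count ≤ total`.
-- Multiplicative weights take the place of linear programming duality, so that everything stays
-- within the natural numbers.

variable
  X Y Z : Set

-- Sums over finite multisets

∑ : List X → (X → ℕ) → ℕ
∑ []       f = 0
∑ (x ∷ xs) f = f x + ∑ xs f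

∑-mono : ∀ (xs : List X) {f g} → (∀ x → f x ≤ g x) → ∑ xs f ≤ ∑ xs g
∑-mono []       h = z≤n
∑-mono (x ∷ xs) h = +-mono-≤ (h x) (∑-mono xs h)

∑-cong : ∀ (xs : List X) {f g} → (∀ x → f x ≡ g x) → ∑ xs f ≡ ∑ xs g
∑-cong []       h = refl
∑-cong (x ∷ xs) h = cong₂ _+_ (h x) (∑-cong xs h)

∑-distrib-+ : ∀ (xs : List X) f g → ∑ xs (λ x → f x + g x) ≡ ∑ xs f + ∑ xs g
∑-distrib-+ []       f g = refl
∑-distrib-+ (x ∷ xs) f g = trans (cong (f x + g x +_) (∑-distrib-+ xs f g))
  (interchange (f x) (g x) (∑ xs f) (∑ xs g))
  where
  interchange : ∀ a b c d → a + b + (c + d) ≡ a + c + (b + d)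
  interchange = solve-∀

*-distribˡ-∑ : ∀ c (xs : List X) f → c * ∑ xs f ≡ ∑ xs (λ x → c * f x)
*-distribˡ-∑ c []       f = *-zeroʳ c
*-distribˡ-∑ c (x ∷ xs) f = trans (*-distribˡ-+ c (f x) (∑ xs f)) (cong (c * f x +_) (*-distribˡ-∑ c xs f))

∑-const : ∀ (xs : List X) c → ∑ xs (λ _ → c) ≡ length xs * c
∑-const []       c = refl
∑-const (x ∷ xs) c = cong (c +_) (∑-const xs c)

∑-≤-const : ∀ (xs : List X) {f} c → (∀ x → f x ≤ c) → ∑ xs f ≤ length xs * c
∑-≤-const xs c h = ≤-trans (∑-mono xs h) (≤-reflexive (∑-const xs c))

∑-swap : ∀ (xs : List X) (ys : List Y) (f : X → Y → ℕ) →
  ∑ xs (λ x → ∑ ys (f x)) ≡ ∑ ys (λ y → ∑ xs (λ x → f x y))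
∑-swap []       ys f = sym (trans (∑-const ys 0) (*-zeroʳ (length ys)))
∑-swap (x ∷ xs) ys f = trans (cong (∑ ys (f x) +_) (∑-swap xs ys f))
  (sym (∑-distrib-+ ys (f x) _))

∑-++ : ∀ (xs ys : List X) f → ∑ (xs ++ ys) f ≡ ∑ xs f + ∑ ys f
∑-++ []       ys f = refl
∑-++ (x ∷ xs) ys f = trans (cong (f x +_) (∑-++ xs ys f)) (sym (+-assoc (f x) _ _))

∑-map : ∀ (g : X → Y) xs f → ∑ (map g xs) f ≡ ∑ xs (λ x → f (g x))
∑-map g []       f = refl
∑-map g (x ∷ xs) f = cong (f (g x) +_) (∑-map g xs f)

∑-cartesianProductWith : ∀ (g : X → Y → Z) xs ys f →
  ∑ (cartesianProductWith g xs ys) f ≡ ∑ xs (λ x → ∑ ys (λ y → f (g x y)))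
∑-cartesianProductWith g []       ys f = refl
∑-cartesianProductWith g (x ∷ xs) ys f = trans (∑-++ (map (g x) ys) _ f)
  (cong₂ _+_ (∑-map (g x) ys f) (∑-cartesianProductWith g xs ys f))

∈⇒≤∑ : ∀ {x : X} {xs} f → x List.∈ xs → f x ≤ ∑ xs f
∈⇒≤∑ f (here refl) = m≤m+n _ _
∈⇒≤∑ f (there i)   = ≤-trans (∈⇒≤∑ f i) (m≤n+m _ _)

∑<length⇒∃0 : ∀ (xs : List X) f → ∑ xs f < length xs → ∃[ x ] f x ≡ 0
∑<length⇒∃0 (x ∷ xs) f lt with f x in eq
... | zero  = x , eq
... | suc k = ∑<length⇒∃0 xs f (≤-trans (s≤s (m≤n+m _ k)) (s≤s⁻¹ lt))

ι : Bool → ℕ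
ι true  = 1
ι false = 0

ι≤1 : ∀ b → ι b ≤ 1
ι≤1 true  = ≤-refl
ι≤1 false = z≤n

ι≡0 : ∀ b → ι b ≡ 0 → b ≡ false
ι≡0 false _ = refl

∑-filterᵇ : ∀ (p : X → Bool) xs f → ∑ (filterᵇ p xs) f ≡ ∑ xs (λ x → ι (p x) * f x)
∑-filterᵇ p []       f = refl
∑-filterᵇ p (x ∷ xs) f with p x
... | true  = cong₂ _+_ (sym (+-identityʳ (f x))) (∑-filterᵇ p xs f)
... | false = ∑-filterᵇ p xs f

-- Tuples with entries from a multiset

vecs : List X → ∀ m → List (Vec X m)
vecs xs zero    = [] ∷ []
vecs xs (suc m) = cartesianProductWith _∷_ xs (vecs xs m)

∑-vecs-suc : ∀ (xs : List X) m f → ∑ (vecs xs (suc m)) f ≡ ∑ xs (λ x → ∑ (vecs xs m) (λ v → f (x ∷ v)))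
∑-vecs-suc xs m f = ∑-cartesianProductWith _∷_ xs (vecs xs m) f

length-as-∑ : ∀ (xs : List X) → length xs ≡ ∑ xs (λ _ → 1)
length-as-∑ xs = sym (trans (∑-const xs 1) (*-identityʳ _))

length-vecs : ∀ (xs : List X) m → length (vecs xs m) ≡ length xs ^ m
length-vecs xs zero    = refl
length-vecs xs (suc m) = begin
  length (vecs xs (suc m))              ≡⟨ length-as-∑ (vecs xs (suc m)) ⟩
  ∑ (vecs xs (suc m)) (λ _ → 1)         ≡⟨ ∑-vecs-suc xs m _ ⟩
  ∑ xs (λ _ → ∑ (vecs xs m) (λ _ → 1))  ≡⟨ ∑-const xs _ ⟩
  length xs * ∑ (vecs xs m) (λ _ → 1)   ≡⟨ cong (length xs *_) (sym (length-as-∑ (vecs xs m))) ⟩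
  length xs * length (vecs xs m)        ≡⟨ cong (length xs *_) (length-vecs xs m) ⟩
  length xs * length xs ^ m             ∎
  where open ≡-Reasoning

-- Fubini, with coordinate `l` summed while the others are held fixed. A condition on entry `l` that
-- the other entries determine is then as rare among tuples as among single draws.
∑-vecs-coordinate : ∀ (xs : List X) m (l : Fin (suc m)) f q →
  (∀ v → q * ∑ xs (λ x → f (insertAt v l x)) ≤ length xs) →
  q * ∑ (vecs xs (suc m)) f ≤ length xs ^ suc m
∑-vecs-coordinate xs m zero f q h = begin
  q * ∑ (vecs xs (suc m)) f                              ≡⟨ cong (q *_) (∑-vecs-suc xs m f) ⟩
  q * ∑ xs (λ x → ∑ (vecs xs m) (λ v → f (x ∷ v)))       ≡⟨ cong (q *_) (∑-swap xs (vecs xs m) _) ⟩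
  q * ∑ (vecs xs m) (λ v → ∑ xs (λ x → f (x ∷ v)))       ≡⟨ *-distribˡ-∑ q (vecs xs m) _ ⟩
  ∑ (vecs xs m) (λ v → q * ∑ xs (λ x → f (x ∷ v)))       ≤⟨ ∑-≤-const (vecs xs m) (length xs) h ⟩
  length (vecs xs m) * length xs                         ≡⟨ *-comm (length (vecs xs m)) _ ⟩
  length xs * length (vecs xs m)                         ≡⟨ cong (length xs *_) (length-vecs xs m) ⟩
  length xs ^ suc m                                      ∎
  where open ≤-Reasoning
∑-vecs-coordinate xs (suc m) (suc l) f q h = begin
  q * ∑ (vecs xs (suc (suc m))) f                          ≡⟨ cong (q *_) (∑-vecs-suc xs (suc m) f) ⟩
  q * ∑ xs (λ x → ∑ (vecs xs (suc m)) (λ v → f (x ∷ v)))   ≡⟨ *-distribˡ-∑ q xs _ ⟩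
  ∑ xs (λ x → q * ∑ (vecs xs (suc m)) (λ v → f (x ∷ v)))   ≤⟨ ∑-≤-const xs _ (λ x →
                                                                ∑-vecs-coordinate xs m l (λ v → f (x ∷ v)) q (λ v → h (x ∷ v))) ⟩
  length xs ^ suc (suc m)                                  ∎
  where open ≤-Reasoning

union-bound : ∀ q (xs : List X) (ys : List Y) {f : Y → X → ℕ} B → (∀ y → q * ∑ xs (f y) ≤ B) →
  q * ∑ xs (λ x → ∑ ys (λ y → f y x)) ≤ length ys * B
union-bound q xs ys {f} B h = begin
  q * ∑ xs (λ x → ∑ ys (λ y → f y x))  ≡⟨ cong (q *_) (∑-swap xs ys (λ x y → f y x)) ⟩
  q * ∑ ys (λ y → ∑ xs (f y))          ≡⟨ *-distribˡ-∑ q ys _ ⟩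
  ∑ ys (λ y → q * ∑ xs (f y))          ≤⟨ ∑-≤-const ys B h ⟩
  length ys * B                        ∎
  where open ≤-Reasoning

-- Random sampling: if every set F x y is light for the multiset xs, then the
-- expected number of triples (i , j , l) with v l in F (v i) (v j) is below 1.

module Sampling (hit : X → Y → Bool) (F : X → X → Y) (xs : List X) (q : ℕ)
  (light : ∀ x y → q * ∑ xs (λ z → ι (hit z (F x y))) ≤ length xs) where

  -- The value is 0 when `l` is `i` or `j`: there the set `F (v i) (v j)` moves with `v l`, and
  -- lightness gives no estimate.
  clash : ∀ {m} → Fin m → Fin m → Fin m → Vec X m → ℕ
  clash i j l v with i ≟ l | j ≟ l
  ... | no _  | no _  = ι (hit (lookup v l) (F (lookup v i) (lookup v j)))
  ... | _     | _     = 0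

  clash≡0 : ∀ {m} {i j l : Fin m} v → clash i j l v ≡ 0 → i ≢ l → j ≢ l →
    hit (lookup v l) (F (lookup v i) (lookup v j)) ≡ false
  clash≡0 {i = i} {j} {l} v eq i≢l j≢l with i ≟ l | j ≟ l
  ... | no _  | no _  = ι≡0 _ eq
  ... | yes e | _     = ⊥-elim (i≢l e)
  ... | no _  | yes e = ⊥-elim (j≢l e)

  none : ∀ m → q * ∑ (vecs xs m) (λ _ → 0) ≤ length xs ^ m
  none m = ≤-trans (≤-reflexive (trans (cong (q *_) (trans (∑-const (vecs xs m) 0) (*-zeroʳ (length (vecs xs m))))) (*-zeroʳ q))) z≤n

  clash-rare : ∀ {m} (i j l : Fin m) → q * ∑ (vecs xs m) (clash i j l) ≤ length xs ^ m
  clash-rare {suc m} i j l with i ≟ l | j ≟ l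
  ... | yes _ | yes _ = none (suc m)
  ... | yes _ | no _  = none (suc m)
  ... | no _  | yes _ = none (suc m)
  ... | no i≢l | no j≢l = ∑-vecs-coordinate xs m l _ q λ v →
    ≤-trans (*-monoʳ-≤ q (≤-reflexive (∑-cong xs (λ x → cong ι (cong₂ hit (insertAt-lookup v l x)
      (cong₂ F (other v x i i≢l) (other v x j j≢l))))))) (light _ _)
    where
    other : ∀ v x i (i≢l : i ≢ l) → lookup (insertAt v l x) i ≡ lookup v (punchOut (λ e → i≢l (sym e)))
    other v x i i≢l = trans (cong (lookup (insertAt v l x)) (sym (punchIn-punchOut (λ e → i≢l (sym e)))))
                            (insertAt-punchIn v l x _)

  clashes : ∀ {m} → Vec X m → ℕ
  clashes {m} v = ∑ (allFin m) λ i → ∑ (allFin m) λ j → ∑ (allFin m) λ l → clash i j l v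

  clashes-rare : ∀ m → q * ∑ (vecs xs m) clashes ≤ m * (m * (m * length xs ^ m))
  clashes-rare m = subst (λ k → q * ∑ (vecs xs m) clashes ≤ k * (k * (k * length xs ^ m))) (length-tabulate {n = m} id)
    (union-bound q (vecs xs m) is _ λ i → union-bound q (vecs xs m) is _ λ j →
       union-bound q (vecs xs m) is _ λ l → clash-rare i j l)
    where is = allFin m

  sample : ∀ m → 0 < length xs → m * (m * m) < q →
    Σ[ v ∈ Vec X m ] (∀ i j l → i ≢ l → j ≢ l → hit (lookup v l) (F (lookup v i) (lookup v j)) ≡ false)
  sample m 0<L m³<q with ∑<length⇒∃0 (vecs xs m) clashes few
    where
    B = length xs ^ m
    instance
      L≢0 : NonZero (length xs)
      L≢0 = >-nonZero 0<L
    cube : ∀ m B → m * (m * (m * B)) ≡ m * (m * m) * B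
    cube = solve-∀
    few : ∑ (vecs xs m) clashes < length (vecs xs m)
    few = subst (∑ (vecs xs m) clashes <_) (sym (length-vecs xs m)) (*-cancelˡ-< q _ _ (begin-strict
      q * ∑ (vecs xs m) clashes   ≤⟨ clashes-rare m ⟩
      m * (m * (m * B))           ≡⟨ cube m B ⟩
      m * (m * m) * B             <⟨ *-monoˡ-< B {{m^n≢0 (length xs) m}} m³<q ⟩
      q * B                       ∎))
      where open ≤-Reasoning
  ... | v , none = v , λ i j l → clash≡0 v (at l (at j (at i none)))
    where
    at : ∀ {f : Fin m → ℕ} i → ∑ (allFin m) f ≡ 0 → f i ≡ 0
    at {f} i eq = n≤0⇒n≡0 (≤-trans (∈⇒≤∑ f (∈-allFin i)) (≤-reflexive eq))

-- Inequalities for powers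

bernoulli : ∀ r k → r ^ suc k + suc k * r ^ k ≤ suc r ^ suc k
bernoulli r zero    = ≤-reflexive (base r)
  where
  base : ∀ r → r * 1 + 1 ≡ suc r * 1
  base = solve-∀
bernoulli r (suc k) = begin
  r * (r * p) + suc (suc k) * (r * p)              ≤⟨ m≤m+n _ (suc k * p) ⟩
  r * (r * p) + suc (suc k) * (r * p) + suc k * p  ≡⟨ expand r k p ⟩
  suc r * (r * p + suc k * p)                      ≤⟨ *-monoʳ-≤ (suc r) (bernoulli r k) ⟩
  suc r ^ suc (suc k)                              ∎
  where
  open ≤-Reasoning
  p = r ^ k
  expand : ∀ r k p → r * (r * p) + suc (suc k) * (r * p) + suc k * p ≡ suc r * (r * p + suc k * p)
  expand = solve-∀

n<2^n : ∀ n → n < 2 ^ n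
n<2^n zero    = s≤s z≤n
n<2^n (suc n) = ≤-trans (+-mono-≤ (m^n>0 2 n) (n<2^n n)) (≤-reflexive (cong (2 ^ n +_) (sym (+-identityʳ _))))

^-distribʳ-* : ∀ k m n → (m * n) ^ k ≡ m ^ k * n ^ k
^-distribʳ-* zero    m n = refl
^-distribʳ-* (suc k) m n = trans (cong (m * n *_) (^-distribʳ-* k m n)) (interchange m n (m ^ k) (n ^ k))
  where
  interchange : ∀ m n p q → m * n * (p * q) ≡ m * p * (n * q)
  interchange = solve-∀

-- Multiplicative weights: double the multiplicity of every row that the current
-- column misses.  The total grows by a factor of at most 2 - 1/q per round, so no
-- row can be missed too often.
module Reweighting {a} (hit : Fin a → Y → Bool) where

  hits : Fin a → List Y → ℕ
  hits v ys = ∑ ys (λ y → ι (hit v y))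

  misses : Y → Fin a → Bool
  misses y v = not (hit v y)

  -- Weights are multiplicities in a list: `v` occurs `2 ^ k` times when `k` of the columns miss it,
  -- and a uniform draw from the list is a weighted draw. The latest column is at the head.
  reweight : List Y → List (Fin a)
  reweight []       = allFin a
  reweight (y ∷ ys) = reweight ys ++ filterᵇ (misses y) (reweight ys)

  multiplicity : Fin a → List (Fin a) → ℕ
  multiplicity v xs = ∑ xs (λ x → ι (does (v ≟ x)))

  Heavy : ℕ → List (Fin a) → Y → Set
  Heavy q xs y = length xs ≤ q * ∑ xs (λ x → ι (hit x y))

  data Greedy (q : ℕ) : List Y → Set where
    []  : Greedy q []
    _∷_ : ∀ {y ys} → Heavy q (reweight ys) y → Greedy q ys → Greedy q (y ∷ ys)

  ∑-reweight : ∀ y ys f → ∑ (reweight (y ∷ ys)) f ≡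
    ∑ (reweight ys) (λ x → f x + ι (misses y x) * f x)
  ∑-reweight y ys f = begin
    ∑ (reweight (y ∷ ys)) f                                             ≡⟨ ∑-++ (reweight ys) _ f ⟩
    ∑ (reweight ys) f + ∑ (filterᵇ (misses y) (reweight ys)) f          ≡⟨ cong (∑ (reweight ys) f +_) (∑-filterᵇ (misses y) (reweight ys) f) ⟩
    ∑ (reweight ys) f + ∑ (reweight ys) (λ x → ι (misses y x) * f x)    ≡⟨ sym (∑-distrib-+ (reweight ys) f _) ⟩
    ∑ (reweight ys) (λ x → f x + ι (misses y x) * f x)                  ∎
    where open ≡-Reasoning

  -- Every miss doubles the weight of `v`, and hits and misses add up to the number of columns. The
  -- factor `2 ^ hits` avoids a subtraction in the exponent.
  multiplicity-lower : ∀ v ys → 2 ^ length ys ≤ 2 ^ hits v ys * multiplicity v (reweight ys)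
  multiplicity-lower v [] = ≤-trans (≤-trans (≤-reflexive (cong ι (sym (dec-true (v ≟ v) refl)))) (∈⇒≤∑ _ (∈-allFin v)))
                              (≤-reflexive (sym (+-identityʳ _)))
  multiplicity-lower v (y ∷ ys) = begin
    2 * 2 ^ length ys                                     ≤⟨ *-monoʳ-≤ 2 (multiplicity-lower v ys) ⟩
    2 * (2 ^ hits v ys * μ)                               ≤⟨ split (hit v y) (2 ^ hits v ys) ⟩
    2 ^ ι (hit v y) * 2 ^ hits v ys * (suc (ι (misses y v)) * μ) ≡⟨ cong₂ _*_ (sym (^-distribˡ-+-* 2 (ι (hit v y)) _)) (sym new) ⟩
    2 ^ (ι (hit v y) + hits v ys) * multiplicity v (reweight (y ∷ ys)) ∎
    where
    open ≤-Reasoning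
    μ = multiplicity v (reweight ys)
    split : ∀ b p → 2 * (p * μ) ≤ 2 ^ ι b * p * (suc (ι (not b)) * μ)
    split true p = ≤-reflexive (eq p μ)
      where
      eq : ∀ p μ → 2 * (p * μ) ≡ (2 * p) * (1 * μ)
      eq = solve-∀
    split false p = ≤-reflexive (eq p μ)
      where
      eq : ∀ p μ → 2 * (p * μ) ≡ (1 * p) * (2 * μ)
      eq = solve-∀
    at-v : ∀ x → ι (does (v ≟ x)) + ι (misses y x) * ι (does (v ≟ x)) ≡ suc (ι (misses y v)) * ι (does (v ≟ x))
    at-v x with v ≟ x
    ... | yes refl = refl
    ... | no _     = trans (*-zeroʳ (ι (misses y x))) (sym (*-zeroʳ (suc (ι (misses y v)))))
    new : multiplicity v (reweight (y ∷ ys)) ≡ suc (ι (misses y v)) * μ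
    new = trans (∑-reweight y ys _) (trans (∑-cong (reweight ys) at-v) (sym (*-distribˡ-∑ (suc (ι (misses y v))) (reweight ys) _)))

  -- Here `r` is `2q - 1`. If the column hits `c` of the `L` entries, the new length is `2L - c`,
  -- and heaviness says `c ≥ L / q`.
  length-reweight : ∀ q r → suc r ≡ 2 * q → ∀ {y ys} → Heavy q (reweight ys) y →
    q * length (reweight (y ∷ ys)) ≤ r * length (reweight ys)
  length-reweight q r e {y} {ys} heavy = +-cancelʳ-≤ (q * c) _ _ (begin
    q * length (reweight (y ∷ ys)) + q * c     ≡⟨ sym (*-distribˡ-+ q _ c) ⟩
    q * (length (reweight (y ∷ ys)) + c)       ≡⟨ cong (q *_) balance ⟩
    q * (L * 2)                                ≡⟨ shuffle q L ⟩
    2 * q * L                                  ≡⟨ cong (_* L) (sym e) ⟩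
    L + r * L                                  ≤⟨ +-monoˡ-≤ (r * L) heavy ⟩
    q * c + r * L                              ≡⟨ +-comm (q * c) _ ⟩
    r * L + q * c                              ∎)
    where
    open ≤-Reasoning
    L = length (reweight ys)
    c = ∑ (reweight ys) (λ x → ι (hit x y))
    shuffle : ∀ q L → q * (L * 2) ≡ 2 * q * L
    shuffle = solve-∀
    two : ∀ b → 1 + ι (not b) * 1 + ι b ≡ 2
    two true  = refl
    two false = refl
    balance : length (reweight (y ∷ ys)) + c ≡ L * 2
    balance = trans (cong (_+ c) (trans (length-as-∑ (reweight (y ∷ ys))) (∑-reweight y ys _)))
      (trans (sym (∑-distrib-+ (reweight ys) _ _))
      (trans (∑-cong (reweight ys) (λ x → two (hit x y))) (∑-const (reweight ys) 2)))

  total-upper : ∀ q r → suc r ≡ 2 * q → ∀ {ys} → Greedy q ys →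
    q ^ length ys * length (reweight ys) ≤ a * r ^ length ys
  total-upper q r e [] = ≤-reflexive (trans (+-identityʳ _) (trans (length-tabulate {n = a} id) (sym (*-identityʳ a))))
  total-upper q r e (_∷_ {y} {ys} heavy g) = begin
    q * Q * length (reweight (y ∷ ys))    ≡⟨ left q Q _ ⟩
    Q * (q * length (reweight (y ∷ ys)))  ≤⟨ *-monoʳ-≤ Q (length-reweight q r e {y} {ys} heavy) ⟩
    Q * (r * L)                           ≡⟨ sym (left r Q L) ⟩
    r * Q * L                             ≡⟨ *-assoc r Q L ⟩
    r * (Q * L)                           ≤⟨ *-monoʳ-≤ r (total-upper q r e g) ⟩
    r * (a * r ^ length ys)               ≡⟨ mid r a _ ⟩
    a * (r * r ^ length ys)               ∎
    where
    open ≤-Reasoning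
    Q = q ^ length ys
    L = length (reweight ys)
    left : ∀ q Q x → q * Q * x ≡ Q * (q * x)
    left = solve-∀
    mid : ∀ r a x → r * (a * x) ≡ a * (r * x)
    mid = solve-∀

  -- The weight of `v` is at most the total, so `(2q / r) ^ t ≤ a * 2 ^ h`. The `t` rounds form `2a`
  -- blocks of `2q` rounds, and each block contributes a factor of at least 2 on the left. Hence
  -- `2 ^ (2a) ≤ a * 2 ^ h ≤ 2 ^ (a + h)`, so `h ≥ a = t / (4q)`.
  hits-lower : ∀ q .{{_ : NonZero q}} {ys} → Greedy q ys → length ys ≡ 2 * q * (2 * a) →
    ∀ v → length ys ≤ 4 * q * hits v ys
  hits-lower q@(suc p) {ys} g len v = begin
    length ys           ≡⟨ len ⟩
    2 * q * (2 * a)     ≡⟨ four q a ⟩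
    4 * q * a           ≤⟨ *-monoʳ-≤ (4 * q) a≤h ⟩
    4 * q * h           ∎
    where
    open ≤-Reasoning
    h = hits v ys
    t = length ys
    r = p + (suc p + 0)
    instance
      Q≢0 : NonZero ((2 * q) ^ t)
      Q≢0 = m^n≢0 (2 * q) t
    four : ∀ q a → 2 * q * (2 * a) ≡ 4 * q * a
    four = solve-∀
    -- `2 * q` unfolds to `suc r`. In `bernoulli r r` the second term `suc r * r ^ r` is at least
    -- `r ^ suc r`, which doubles the first.
    halve : 2 * r ^ (2 * q) ≤ (2 * q) ^ (2 * q)
    halve = ≤-trans (≤-trans (≤-reflexive (cong (r ^ (2 * q) +_) (+-identityʳ _))) (+-monoʳ-≤ (r ^ (2 * q)) (m≤n+m _ (r ^ r)))) (bernoulli r r)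
    decay : r ^ t * 2 ^ (2 * a) ≤ (2 * q) ^ t
    decay = begin
      r ^ t * 2 ^ (2 * a)                            ≡⟨ cong (λ t → r ^ t * 2 ^ (2 * a)) len ⟩
      r ^ (2 * q * (2 * a)) * 2 ^ (2 * a)            ≡⟨ cong (_* 2 ^ (2 * a)) (sym (^-*-assoc r (2 * q) (2 * a))) ⟩
      (r ^ (2 * q)) ^ (2 * a) * 2 ^ (2 * a)          ≡⟨ sym (^-distribʳ-* (2 * a) (r ^ (2 * q)) 2) ⟩
      (r ^ (2 * q) * 2) ^ (2 * a)                    ≤⟨ ^-monoˡ-≤ (2 * a) (≤-trans (≤-reflexive (*-comm (r ^ (2 * q)) 2)) halve) ⟩
      ((2 * q) ^ (2 * q)) ^ (2 * a)                  ≡⟨ ^-*-assoc (2 * q) (2 * q) (2 * a) ⟩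
      (2 * q) ^ (2 * q * (2 * a))                    ≡⟨ cong ((2 * q) ^_) (sym len) ⟩
      (2 * q) ^ t                                    ∎
    total : (2 * q) ^ t ≤ 2 ^ h * (a * r ^ t)
    total = begin
      (2 * q) ^ t                                        ≡⟨ ^-distribʳ-* t 2 q ⟩
      2 ^ t * q ^ t                                      ≤⟨ *-monoˡ-≤ (q ^ t) (multiplicity-lower v ys) ⟩
      2 ^ h * multiplicity v (reweight ys) * q ^ t       ≤⟨ *-monoˡ-≤ (q ^ t) (*-monoʳ-≤ (2 ^ h) below) ⟩
      2 ^ h * length (reweight ys) * q ^ t               ≡⟨ *-assoc (2 ^ h) _ _ ⟩
      2 ^ h * (length (reweight ys) * q ^ t)             ≡⟨ cong (2 ^ h *_) (*-comm (length (reweight ys)) _) ⟩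
      2 ^ h * (q ^ t * length (reweight ys))             ≤⟨ *-monoʳ-≤ (2 ^ h) (total-upper q r refl g) ⟩
      2 ^ h * (a * r ^ t)                                ∎
      where
      below : multiplicity v (reweight ys) ≤ length (reweight ys)
      below = ≤-trans (∑-≤-const (reweight ys) 1 (λ x → ι≤1 _)) (≤-reflexive (*-identityʳ _))
    exponents : 2 ^ (2 * a) ≤ 2 ^ (h + a)
    exponents = *-cancelˡ-≤ ((2 * q) ^ t) (begin
      (2 * q) ^ t * 2 ^ (2 * a)               ≤⟨ *-monoˡ-≤ (2 ^ (2 * a)) total ⟩
      2 ^ h * (a * r ^ t) * 2 ^ (2 * a)       ≡⟨ regroup (2 ^ h) a (r ^ t) (2 ^ (2 * a)) ⟩
      r ^ t * 2 ^ (2 * a) * (2 ^ h * a)       ≤⟨ *-mono-≤ decay (*-monoʳ-≤ (2 ^ h) (<⇒≤ (n<2^n a))) ⟩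
      (2 * q) ^ t * (2 ^ h * 2 ^ a)           ≡⟨ cong ((2 * q) ^ t *_) (sym (^-distribˡ-+-* 2 h a)) ⟩
      (2 * q) ^ t * 2 ^ (h + a)               ∎)
      where
      regroup : ∀ x a y z → x * (a * y) * z ≡ y * z * (x * a)
      regroup = solve-∀
    2a≤h+a : 2 * a ≤ h + a
    2a≤h+a = ≮⇒≥ λ lt → <⇒≱ (^-monoʳ-< 2 (s≤s (s≤s z≤n)) lt) exponents
    a≤h : a ≤ h
    a≤h = +-cancelʳ-≤ a _ _ (≤-trans (≤-reflexive (cong (a +_) (sym (+-identityʳ a)))) 2a≤h+a)

-- The configuration whose size is λ in Ding–Seymour–Winkler.  For a column F x y
-- only the incidence with x is known in general, hence the first case of target.
record Scattered {a} (hit : Fin a → Y → Bool) (F : Fin a → Fin a → Y) (m : ℕ) : Set where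
  field
    row     : Fin m → Fin a
    column  : Fin m → Fin m → Y
    avoid   : ∀ i j l → i ≢ l → j ≢ l → hit (row l) (column i j) ≡ false
    source  : ∀ i j → hit (row i) (column i j) ≡ true
    target  : ∀ i j → column i j ≡ F (row i) (row j) ⊎ hit (row j) (column i j) ≡ true

-- Greedy choice of columns and the fractional cover

module _ {a} (hit : Fin a → Y → Bool) (F : Fin a → Fin a → Y) (F-source : ∀ x y → hit x (F x y) ≡ true)
  (0<a : 0 < a) (m q : ℕ) (m³<q : m * (m * m) < q) where

  open Reweighting hit

  reweight-nonempty : ∀ ys → 0 < length (reweight ys)
  reweight-nonempty []       = subst (0 <_) (sym (length-tabulate {n = a} id)) 0<a
  reweight-nonempty (y ∷ ys) = ≤-trans (reweight-nonempty ys)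
    (≤-trans (m≤m+n _ _) (≤-reflexive (sym (length-++ (reweight ys)))))

  -- The type of columns cannot be searched, but the `a * a` values of `F` can. If none of them is
  -- heavy, this is exactly the lightness that sampling asks for.
  heavy-or-scattered : ∀ xs → 0 < length xs → ∃[ y ] Heavy q xs y ⊎ Scattered hit F m
  heavy-or-scattered xs 0<L with any? (λ x → any? (λ y → length xs ≤? q * ∑ xs (λ z → ι (hit z (F x y)))))
  ... | yes (x , y , heavy) = inj₁ (F x y , heavy)
  ... | no light = inj₂ (record
    { row = lookup v ; column = λ i j → F (lookup v i) (lookup v j)
    ; avoid = good ; source = λ i j → F-source _ _ ; target = λ i j → inj₁ refl })
    where
    sampled = Sampling.sample hit F xs q (λ x y → <⇒≤ (≰⇒> λ h → light (x , y , h))) m 0<L m³<q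
    v = proj₁ sampled
    good = proj₂ sampled

  greedy : ∀ t → (∃[ ys ] (length ys ≡ t × Greedy q ys)) ⊎ Scattered hit F m
  greedy zero = inj₁ ([] , refl , [])
  greedy (suc t) with greedy t
  ... | inj₂ s = inj₂ s
  ... | inj₁ (ys , len , g) with heavy-or-scattered (reweight ys) (reweight-nonempty ys)
  ...   | inj₂ s           = inj₂ s
  ...   | inj₁ (y , heavy) = inj₁ (y ∷ ys , cong suc len , heavy ∷ g)

  fractional-cover : (∃[ ys ] (0 < length ys × ∀ v → length ys ≤ 4 * q * hits v ys)) ⊎ Scattered hit F m
  fractional-cover with greedy (2 * q * (2 * a))
  ... | inj₂ s = inj₂ s
  ... | inj₁ (ys , len , g) = inj₁ (ys , subst (0 <_) (sym len) (>-nonZero⁻¹ _) , hits-lower q g len)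
    where
    instance
      q≢0 : NonZero q
      q≢0 = >-nonZero (≤-trans (s≤s z≤n) m³<q)
      a≢0 : NonZero a
      a≢0 = >-nonZero 0<a
      2q≢0 : NonZero (2 * q)
      2q≢0 = m*n≢0 2 q
      2a≢0 : NonZero (2 * a)
      2a≢0 = m*n≢0 2 a
      t≢0 : NonZero (2 * q * (2 * a))
      t≢0 = m*n≢0 (2 * q) (2 * a)

-- Sauer–Shelah

Shattered : ∀ {N} → List (Vec Bool N) → ℕ → Set
Shattered {N} 𝓕 d = Σ[ e ∈ Vec (Fin N) d ] (∀ p → ∃[ t ] (t List.∈ 𝓕 × Vec.map (lookup t) e ≡ p))

-- Induction on the first coordinate, with `tails` for the projection and `both` for the tails
-- having both extensions. The second outcome is a short list containing `𝓕`, not a bound on the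
-- length of `𝓕`, which may repeat a vector many times. The bound `(N + 1) ^ d` replaces the sum of
-- binomial coefficients, since it satisfies the same recursion as an inequality.
sauer-shelah : ∀ N d (𝓕 : List (Vec Bool N)) →
  Shattered 𝓕 d ⊎ ∃[ 𝒯 ] (length 𝒯 ≤ suc N ^ d × (∀ t → t List.∈ 𝓕 → t List.∈ 𝒯))
sauer-shelah N zero []      = inj₂ ([] , z≤n , λ _ t∈ → t∈)
sauer-shelah N zero (t ∷ _) = inj₁ ([] , λ { [] → t , here refl , refl })
sauer-shelah zero (suc d) 𝓕 = inj₂ ([] ∷ [] , m^n>0 1 (suc d) , λ { [] _ → here refl })
sauer-shelah (suc N) (suc d) 𝓕 = assemble (sauer-shelah N (suc d) tails) (sauer-shelah N d both)
  where
  open import Data.List.Membership.DecPropositional (≡-dec {n = suc N} Bool._≟_) using () renaming (_∈?_ to _∈ᵗ?_)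

  both? : ∀ t → Dec (true ∷ t List.∈ 𝓕 × false ∷ t List.∈ 𝓕)
  both? t = (true ∷ t) ∈ᵗ? 𝓕 ×-dec (false ∷ t) ∈ᵗ? 𝓕

  tails both : List (Vec Bool N)
  tails = map Vec.tail 𝓕
  both  = filter both? tails

  first : Vec Bool N → Bool
  first t = does ((true ∷ t) ∈ᵗ? 𝓕)

  shift : ∀ {d} b (t : Vec Bool N) (e : Vec (Fin N) d) →
    Vec.map (lookup (b ∷ t)) (Vec.map suc e) ≡ Vec.map (lookup t) e
  shift b t e = sym (map-∘ (lookup (b ∷ t)) suc e)

  assemble : Shattered tails (suc d) ⊎ ∃[ 𝒯 ] (length 𝒯 ≤ suc N ^ suc d × (∀ t → t List.∈ tails → t List.∈ 𝒯)) →
    Shattered both d ⊎ ∃[ 𝒯 ] (length 𝒯 ≤ suc N ^ d × (∀ t → t List.∈ both → t List.∈ 𝒯)) →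
    Shattered 𝓕 (suc d) ⊎ ∃[ 𝒯 ] (length 𝒯 ≤ suc (suc N) ^ suc d × (∀ t → t List.∈ 𝓕 → t List.∈ 𝒯))
  assemble (inj₁ (e , realise)) _ = inj₁ (Vec.map suc e , λ p → lift p (realise p))
    where
    lift : ∀ p → ∃[ t ] (t List.∈ tails × Vec.map (lookup t) e ≡ p) →
      ∃[ t ] (t List.∈ 𝓕 × Vec.map (lookup t) (Vec.map suc e) ≡ p)
    lift p (t , t∈ , eq) with ∈-map⁻ Vec.tail t∈
    ... | (b ∷ .t) , bt∈ , refl = b ∷ t , bt∈ , trans (shift b t e) eq
  assemble (inj₂ _) (inj₁ (e , realise)) = inj₁ (zero ∷ Vec.map suc e , extend)
    where
    extend : ∀ p → ∃[ t ] (t List.∈ 𝓕 × Vec.map (lookup t) (zero ∷ Vec.map suc e) ≡ p)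
    extend (b ∷ p) with realise p
    extend (b ∷ p) | t , t∈ , eq with proj₂ (∈-filter⁻ both? {xs = tails} t∈)
    extend (true ∷ p)  | t , _ , eq | t₁∈ , _ = true ∷ t , t₁∈ , cong (true ∷_) (trans (shift true t e) eq)
    extend (false ∷ p) | t , _ , eq | _ , t₀∈ = false ∷ t , t₀∈ , cong (false ∷_) (trans (shift false t e) eq)
  assemble (inj₂ (𝒯₁ , small₁ , covers₁)) (inj₂ (𝒯₂ , small₂ , covers₂)) =
    -- One extension for every tail, `true` if available; a tail with a second extension lies in
    -- `both`, and that extension starts with `false`.
    inj₂ (map (λ t → first t ∷ t) 𝒯₁ ++ map (false ∷_) 𝒯₂ , small , covers)
    where
    small : length (map (λ t → first t ∷ t) 𝒯₁ ++ map (false ∷_) 𝒯₂) ≤ suc (suc N) ^ suc d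
    small = begin
      length (map (λ t → first t ∷ t) 𝒯₁ ++ map (false ∷_) 𝒯₂)   ≡⟨ length-++ (map (λ t → first t ∷ t) 𝒯₁) ⟩
      length (map (λ t → first t ∷ t) 𝒯₁) + length (map {B = Vec Bool (suc N)} (false ∷_) 𝒯₂)
                                                                   ≡⟨ cong₂ _+_ (length-map _ 𝒯₁) (length-map _ 𝒯₂) ⟩
      length 𝒯₁ + length 𝒯₂                                       ≤⟨ +-mono-≤ small₁ small₂ ⟩
      suc N ^ suc d + suc N ^ d                                    ≡⟨ +-comm (suc N ^ suc d) _ ⟩
      suc (suc N) * suc N ^ d                                      ≤⟨ *-monoʳ-≤ (suc (suc N)) (^-monoˡ-≤ d (n≤1+n (suc N))) ⟩
      suc (suc N) ^ suc d                                          ∎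
      where open ≤-Reasoning
    at-first : ∀ {t b} → first t ≡ b → t List.∈ tails →
      b ∷ t List.∈ map (λ t → first t ∷ t) 𝒯₁ ++ map (false ∷_) 𝒯₂
    at-first refl t∈ = ∈-++⁺ˡ (∈-map⁺ (λ t → first t ∷ t) (covers₁ _ t∈))
    covers : ∀ t → t List.∈ 𝓕 → t List.∈ map (λ t → first t ∷ t) 𝒯₁ ++ map (false ∷_) 𝒯₂
    covers (true ∷ t) t∈ = at-first (dec-true ((true ∷ t) ∈ᵗ? 𝓕) t∈) (∈-map⁺ Vec.tail t∈)
    covers (false ∷ t) t∈ with (true ∷ t) ∈ᵗ? 𝓕 in eq
    ... | yes t₁∈ = ∈-++⁺ʳ (map (λ t → first t ∷ t) 𝒯₁)
                      (∈-map⁺ (false ∷_) (covers₂ t (∈-filter⁺ both? (∈-map⁺ Vec.tail t∈) (t₁∈ , t∈))))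
    ... | no _    = at-first (cong does eq) (∈-map⁺ Vec.tail t∈)

-- Interleaved pairs of M-tuples and swaps within the pairs

interleave : ∀ {M} → Vec X M → Vec X M → Vec X (M * 2)
interleave []       []       = []
interleave (x ∷ xs) (y ∷ ys) = x ∷ y ∷ interleave xs ys

swaps : ∀ {M} → Vec Bool M → Vec X (M * 2) → Vec X (M * 2)
swaps []          []           = []
swaps (true ∷ σ)  (x ∷ y ∷ zs) = y ∷ x ∷ swaps σ zs
swaps (false ∷ σ) (x ∷ y ∷ zs) = x ∷ y ∷ swaps σ zs

map-interleave : ∀ {M} (f : X → Y) (xs ys : Vec X M) →
  Vec.map f (interleave xs ys) ≡ interleave (Vec.map f xs) (Vec.map f ys)
map-interleave f []       []       = refl
map-interleave f (x ∷ xs) (y ∷ ys) = cong (λ zs → f x ∷ f y ∷ zs) (map-interleave f xs ys)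

map-swaps : ∀ {M} (f : X → Y) (σ : Vec Bool M) (zs : Vec X (M * 2)) → Vec.map f (swaps σ zs) ≡ swaps σ (Vec.map f zs)
map-swaps f []          []           = refl
map-swaps f (true ∷ σ)  (x ∷ y ∷ zs) = cong (λ zs → f y ∷ f x ∷ zs) (map-swaps f σ zs)
map-swaps f (false ∷ σ) (x ∷ y ∷ zs) = cong (λ zs → f x ∷ f y ∷ zs) (map-swaps f σ zs)

∑-vecs-suc² : ∀ (xs : List X) m f → ∑ (vecs xs (suc (suc m))) f ≡
  ∑ xs (λ x → ∑ xs (λ y → ∑ (vecs xs m) (λ zs → f (x ∷ y ∷ zs))))
∑-vecs-suc² xs m f = trans (∑-vecs-suc xs (suc m) f) (∑-cong xs λ x → ∑-vecs-suc xs m _)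

-- Swapping within pairs permutes the tuples; for a single pair this is an exchange of two sums over
-- the same list.
∑-swaps : ∀ (xs : List X) {M} (σ : Vec Bool M) f →
  ∑ (vecs xs (M * 2)) (λ zs → f (swaps σ zs)) ≡ ∑ (vecs xs (M * 2)) f
∑-swaps xs [] f = refl
∑-swaps xs {suc M} (false ∷ σ) f = trans (∑-vecs-suc² xs (M * 2) _)
  (trans (∑-cong xs λ x → ∑-cong xs λ y → ∑-swaps xs σ (λ zs → f (x ∷ y ∷ zs)))
         (sym (∑-vecs-suc² xs (M * 2) f)))
∑-swaps xs {suc M} (true ∷ σ) f = trans (∑-vecs-suc² xs (M * 2) _)
  (trans (∑-cong xs λ x → ∑-cong xs λ y → ∑-swaps xs σ (λ zs → f (y ∷ x ∷ zs)))
  (trans (∑-swap xs xs _) (sym (∑-vecs-suc² xs (M * 2) f))))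

-- Interleaving makes the pair the unit of recursion, so each pair costs one exchange of summations.
∑-interleave : ∀ (xs : List X) M f →
  ∑ (vecs xs (M * 2)) f ≡ ∑ (vecs xs M) (λ u → ∑ (vecs xs M) (λ v → f (interleave u v)))
∑-interleave xs zero f = sym (+-identityʳ _)
∑-interleave xs (suc M) f = begin
  ∑ (vecs xs (suc M * 2)) f
    ≡⟨ ∑-vecs-suc² xs (M * 2) f ⟩
  ∑ xs (λ x → ∑ xs (λ y → ∑ (vecs xs (M * 2)) (λ zs → f (x ∷ y ∷ zs))))
    ≡⟨ ∑-cong xs (λ x → ∑-cong xs (λ y → ∑-interleave xs M _)) ⟩
  ∑ xs (λ x → ∑ xs (λ y → ∑ (vecs xs M) (λ u → ∑ (vecs xs M) (λ v → f (x ∷ y ∷ interleave u v)))))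
    ≡⟨ ∑-cong xs (λ x → ∑-swap xs (vecs xs M) _) ⟩
  ∑ xs (λ x → ∑ (vecs xs M) (λ u → ∑ xs (λ y → ∑ (vecs xs M) (λ v → f (x ∷ y ∷ interleave u v)))))
    ≡⟨ ∑-cong xs (λ x → ∑-cong (vecs xs M) (λ u → sym (∑-vecs-suc xs M _))) ⟩
  ∑ xs (λ x → ∑ (vecs xs M) (λ u → ∑ (vecs xs (suc M)) (λ v → f (interleave (x ∷ u) v))))
    ≡⟨ sym (∑-vecs-suc xs M _) ⟩
  ∑ (vecs xs (suc M)) (λ u → ∑ (vecs xs (suc M)) (λ v → f (interleave u v))) ∎
  where open ≡-Reasoning

count : ∀ {M} → Vec Bool M → ℕ
count []       = 0
count (b ∷ bs) = ι b + count bs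

count≤ : ∀ {M} (bs : Vec Bool M) → count bs ≤ M
count≤ []       = z≤n
count≤ (b ∷ bs) = +-mono-≤ (ι≤1 b) (count≤ bs)

-- The first half of an interleaved tuple is missed and the second is hit at least r times.
lopsided : ∀ M → ℕ → Vec Bool (M * 2) → Bool
lopsided zero    zero    []                  = true
lopsided zero    (suc r) []                  = false
lopsided (suc M) r       (true ∷ _ ∷ t)      = false
-- `pred` stops at 0, so hits beyond the required number do no harm.
lopsided (suc M) r       (false ∷ true ∷ t)  = lopsided M (pred r) t
lopsided (suc M) r       (false ∷ false ∷ t) = lopsided M r t

lopsided-interleave : ∀ M r (bs : Vec Bool M) → r ≤ count bs →
  lopsided M r (interleave (Vec.replicate M false) bs) ≡ true
lopsided-interleave zero    zero []           h = refl
lopsided-interleave (suc M) r (true ∷ bs)  h = lopsided-interleave M (pred r) bs (pred-mono-≤ h)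
lopsided-interleave (suc M) r (false ∷ bs) h = lopsided-interleave M r bs h

-- A reverse Markov inequality: a count bounded by `M` with mean at least `2r` reaches `r` with
-- probability at least `r / M`.
markov : ∀ M r (bs : Vec Bool M) →
  count bs ≤ r + M * ι (lopsided M r (interleave (Vec.replicate M false) bs))
markov M r bs with r ≤? count bs
... | yes h rewrite lopsided-interleave M r bs h =
  ≤-trans (count≤ bs) (≤-trans (≤-reflexive (sym (*-identityʳ M))) (m≤n+m _ r))
... | no  h = ≤-trans (<⇒≤ (≰⇒> h)) (m≤m+n r _)

bools : List Bool
bools = true ∷ false ∷ []

∑-zero : ∀ (xs : List X) → ∑ xs (λ _ → 0) ≡ 0
∑-zero xs = trans (∑-const xs 0) (*-zeroʳ (length xs))

-- A pair hit twice excludes lopsidedness, a pair hit once admits only one of its two orders, and a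
-- pair hit never admits both. Success needs at least `r` pairs hit exactly once, so at most a
-- fraction `2 ^ (-r)` of the swaps succeed.
lopsided-rare : ∀ M r t → 2 ^ r * ∑ (vecs bools M) (λ σ → ι (lopsided M r (swaps σ t))) ≤ 2 ^ M
lopsided-rare zero zero    [] = ≤-refl
lopsided-rare zero (suc r) [] = ≤-trans (≤-reflexive (*-zeroʳ (2 ^ suc r))) z≤n
lopsided-rare (suc M) r (b ∷ c ∷ t) =
  ≤-trans (≤-reflexive (cong (2 ^ r *_) (∑-vecs-suc bools M (λ σ → ι (lopsided (suc M) r (swaps σ (b ∷ c ∷ t)))))))
          (cases b c)
  where
  S : ℕ → ℕ
  S r = ∑ (vecs bools M) (λ σ → ι (lopsided M r (swaps σ t)))
  one : ∀ r → 2 ^ r * S (pred r) ≤ 2 ^ suc M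
  one zero    = ≤-trans (lopsided-rare M 0 t) (m≤m+n _ _)
  one (suc r) = ≤-trans (≤-reflexive (*-assoc 2 (2 ^ r) _)) (*-monoʳ-≤ 2 (lopsided-rare M r t))
  both : 2 ^ r * (2 * S r) ≤ 2 ^ suc M
  both = ≤-trans (≤-reflexive (rot (2 ^ r) (S r))) (*-monoʳ-≤ 2 (lopsided-rare M r t))
    where
    rot : ∀ a b → a * (2 * b) ≡ 2 * (a * b)
    rot = solve-∀
  cases : ∀ b c → 2 ^ r * ∑ bools (λ s → ∑ (vecs bools M) (λ σ → ι (lopsided (suc M) r (swaps (s ∷ σ) (b ∷ c ∷ t))))) ≤ 2 ^ suc M
  cases true  true  rewrite ∑-zero (vecs bools M) = ≤-trans (≤-reflexive (*-zeroʳ (2 ^ r))) z≤n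
  cases true  false rewrite ∑-zero (vecs bools M) | +-identityʳ (S (pred r)) = one r
  cases false true  rewrite ∑-zero (vecs bools M) | +-identityʳ (S (pred r)) = one r
  cases false false = both

all-or : ∀ {P : X → Set} {Q : Set} → (∀ x → P x ⊎ Q) → ∀ xs → All P xs ⊎ Q
all-or f []       = inj₁ []
all-or f (x ∷ xs) with f x | all-or f xs
... | inj₂ q | _       = inj₂ q
... | inj₁ _ | inj₂ q  = inj₂ q
... | inj₁ p | inj₁ ps = inj₁ (p ∷ ps)

∑-mono-All : ∀ (xs : List X) {f g} → All (λ x → f x ≤ g x) xs → ∑ xs f ≤ ∑ xs g
∑-mono-All []       []       = z≤n
∑-mono-All (x ∷ xs) (h ∷ hs) = +-mono-≤ h (∑-mono-All xs hs)

-- ε-nets by double sampling (Haussler–Welzl, Vapnik–Chervonenkis)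
module Net {a} (hit : Fin a → Y → Bool) (ys : List Y) (0<T : 0 < length ys) (Q : ℕ) (0<Q : 0 < Q)
  (heavy : ∀ v → length ys ≤ Q * ∑ ys (λ y → ι (hit v y))) where

  T# = length ys

  trace : ∀ {M} → Fin a → Vec Y M → Vec Bool M
  trace v = Vec.map (hit v)

  Covers : ∀ {M} → Vec Y M → Set
  Covers x = ∀ v → ∃[ i ] hit v (lookup x i) ≡ true

  Realised : ∀ {d} → Vec Y d → Set
  Realised e = ∀ p → ∃[ v ] trace v e ≡ p

  covers-or-misses : ∀ {M} (x : Vec Y M) → ∃[ v ] trace v x ≡ Vec.replicate M false ⊎ Covers x
  covers-or-misses {M} x with all? (λ v → any? (λ i → hit v (lookup x i) Bool.≟ true))
  ... | yes c = inj₂ c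
  ... | no ¬c with ¬∀⟶∃¬ a _ (λ v → any? (λ i → hit v (lookup x i) Bool.≟ true)) ¬c
  ...   | v , ¬h = inj₁ (v , missed x (λ i → ¬-not λ e → ¬h (i , e)))
    where
    missed : ∀ {M} (x : Vec Y M) → (∀ i → hit v (lookup x i) ≡ false) → trace v x ≡ Vec.replicate M false
    missed []      h = refl
    missed (y ∷ x) h = cong₂ _∷_ (h zero) (missed x (λ i → h (suc i)))

  -- Linearity of expectation: each of the `M` draws is hit with probability at least `1/Q`.
  average : ∀ v M → M * T# ^ M ≤ Q * ∑ (vecs ys M) (λ x → count (trace v x))
  average v zero    = z≤n
  average v (suc M) = begin
    suc M * (T# * W)                                             ≡⟨ split M T# W ⟩
    W * T# + T# * (M * W)                                        ≤⟨ +-mono-≤ (*-monoʳ-≤ W (heavy v)) (*-monoʳ-≤ T# (average v M)) ⟩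
    W * (Q * h) + T# * (Q * K)                                   ≡⟨ gather W Q h T# K ⟩
    Q * (W * h + T# * K)                                         ≡⟨ cong (Q *_) (sym total) ⟩
    Q * ∑ (vecs ys (suc M)) (λ x → count (trace v x))            ∎
    where
    open ≤-Reasoning
    W = T# ^ M
    h = ∑ ys (λ y → ι (hit v y))
    K = ∑ (vecs ys M) (λ x → count (trace v x))
    split : ∀ M t W → suc M * (t * W) ≡ W * t + t * (M * W)
    split = solve-∀
    gather : ∀ W Q h t K → W * (Q * h) + t * (Q * K) ≡ Q * (W * h + t * K)
    gather = solve-∀
    total : ∑ (vecs ys (suc M)) (λ x → count (trace v x)) ≡ W * h + T# * K
    total = begin-equality
      ∑ (vecs ys (suc M)) (λ x → count (trace v x))                       ≡⟨ ∑-vecs-suc ys M _ ⟩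
      ∑ ys (λ y → ∑ (vecs ys M) (λ x → ι (hit v y) + count (trace v x)))  ≡⟨ ∑-cong ys (λ y → trans (∑-distrib-+ (vecs ys M) _ _)
                                                                               (cong (_+ K) (trans (∑-const (vecs ys M) _) (cong (_* ι (hit v y)) (length-vecs ys M))))) ⟩
      ∑ ys (λ y → W * ι (hit v y) + K)                                    ≡⟨ ∑-distrib-+ ys _ _ ⟩
      ∑ ys (λ y → W * ι (hit v y)) + ∑ ys (λ _ → K)                       ≡⟨ cong₂ _+_ (sym (*-distribˡ-∑ W ys _)) (∑-const ys K) ⟩
      W * h + T# * K                                                      ∎

  module _ (d R : ℕ) (0<R : 0 < R) (large : 2 * Q * suc ((2 * Q * R) * 2) ^ d < 2 ^ R) where

    -- Chosen so that a row expects at least `2R` hits, twice what `Bad` requires.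
    M = 2 * Q * R

    Bad : Vec Y (M * 2) → Set
    Bad z = ∃[ v ] lopsided M R (trace v z) ≡ true

    bad? : ∀ z → Dec (Bad z)
    bad? z = any? (λ v → lopsided M R (trace v z) Bool.≟ true)

    bad : Vec Y (M * 2) → ℕ
    bad z = ι (does (bad? z))

    -- The row missing `x` expects at least `2R` hits in an independent second half. By `markov` it
    -- gets `R` of them with probability at least `R / M = 1/(2Q)`.
    bad-frequent : ∀ x → ∃[ v ] trace v x ≡ Vec.replicate M false →
      T# ^ M ≤ 2 * Q * ∑ (vecs ys M) (λ y → bad (interleave x y))
    bad-frequent x (v , miss) = *-cancelˡ-≤ (Q * R) {{m*n≢0 Q R {{>-nonZero 0<Q}} {{>-nonZero 0<R}}}}
      (+-cancelˡ-≤ (Q * R * W) _ _ (begin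
        Q * R * W + Q * R * W                     ≡⟨ double Q R W ⟩
        M * W                                     ≤⟨ average v M ⟩
        Q * ∑ (vecs ys M) (λ y → count (trace v y)) ≤⟨ *-monoʳ-≤ Q (∑-mono (vecs ys M) bound) ⟩
        Q * ∑ (vecs ys M) (λ y → R + M * bad (interleave x y)) ≡⟨ cong (Q *_) total ⟩
        Q * (W * R + M * G)                       ≡⟨ spread Q R W G ⟩
        Q * R * W + Q * R * (2 * Q * G)           ∎))
      where
      open ≤-Reasoning
      W = T# ^ M
      G = ∑ (vecs ys M) (λ y → bad (interleave x y))
      double : ∀ Q R W → Q * R * W + Q * R * W ≡ 2 * Q * R * W
      double = solve-∀
      spread : ∀ Q R W G → Q * (W * R + 2 * Q * R * G) ≡ Q * R * W + Q * R * (2 * Q * G)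
      spread = solve-∀
      total : ∑ (vecs ys M) (λ y → R + M * bad (interleave x y)) ≡ W * R + M * G
      total = trans (∑-distrib-+ (vecs ys M) _ _) (cong₂ _+_
        (trans (∑-const (vecs ys M) R) (cong (_* R) (length-vecs ys M))) (sym (*-distribˡ-∑ M (vecs ys M) _)))
      witness : ∀ y → ι (lopsided M R (interleave (Vec.replicate M false) (trace v y))) ≤ bad (interleave x y)
      witness y with lopsided M R (interleave (Vec.replicate M false) (trace v y)) in eq
      ... | false = z≤n
      ... | true  = ≤-reflexive (cong ι (sym (dec-true (bad? (interleave x y)) (v , trans (cong (lopsided M R)
                      (trans (map-interleave (hit v) x y) (cong (λ x → interleave x (trace v y)) miss))) eq))))
      bound : ∀ y → count (trace v y) ≤ R + M * bad (interleave x y)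
      bound y = ≤-trans (markov M R (trace v y)) (+-monoʳ-≤ R (*-monoʳ-≤ M (witness y)))

    -- Lopsidedness depends on a row only through its trace on `z`. The union bound therefore runs
    -- over at most `(2M + 1) ^ d` traces and not over the `a` rows, whose number is unbounded.
    bad-rare : ∀ z → 2 ^ R * ∑ (vecs bools M) (λ σ → bad (swaps σ z)) ≤ suc (M * 2) ^ d * 2 ^ M
                     ⊎ Σ[ e ∈ Vec Y d ] Realised e
    bad-rare z with sauer-shelah (M * 2) d (map (λ v → trace v z) (allFin a))
    ... | inj₁ (e , shattered) = inj₂ (Vec.map (lookup z) e , λ p → realise p (shattered p))
      where
      realise : ∀ p → ∃[ t ] (t List.∈ map (λ v → trace v z) (allFin a) × Vec.map (lookup t) e ≡ p) →
        ∃[ v ] trace v (Vec.map (lookup z) e) ≡ p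
      realise p (t , t∈ , eq) with ∈-map⁻ (λ v → trace v z) t∈
      ... | v , _ , refl = v , trans (sym (map-∘ (hit v) (lookup z) e))
                                 (trans (map-cong (λ i → sym (lookup-map i (hit v) z)) e) eq)
    ... | inj₂ (𝒯 , small , covers) = inj₁ (begin
      2 ^ R * ∑ (vecs bools M) (λ σ → bad (swaps σ z))
        ≤⟨ *-monoʳ-≤ (2 ^ R) (∑-mono (vecs bools M) (λ σ → through σ)) ⟩
      2 ^ R * ∑ (vecs bools M) (λ σ → ∑ 𝒯 (λ t → ι (lopsided M R (swaps σ t))))
        ≤⟨ union-bound (2 ^ R) (vecs bools M) 𝒯 (2 ^ M) (λ t → lopsided-rare M R t) ⟩
      length 𝒯 * 2 ^ M
        ≤⟨ *-monoˡ-≤ (2 ^ M) small ⟩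
      suc (M * 2) ^ d * 2 ^ M ∎)
      where
      open ≤-Reasoning
      through : ∀ (σ : Vec Bool M) → bad (swaps σ z) ≤ ∑ 𝒯 (λ t → ι (lopsided M R (swaps σ t)))
      through σ with bad? (swaps σ z)
      ... | no _ = z≤n
      ... | yes (v , eq) = ≤-trans
        (≤-reflexive (cong ι (sym (trans (cong (lopsided M R) (sym (map-swaps (hit v) σ z))) eq))))
        (∈⇒≤∑ (λ t → ι (lopsided M R (swaps σ t))) (covers _ (∈-map⁺ (λ v → trace v z) (∈-allFin v))))

    -- If every `M`-tuple were missed by some row, at least a fraction `1/(2Q)` of the `2M`-tuples
    -- would be bad. Without a shattered `e` that fraction is at most `(2M + 1) ^ d / 2 ^ R`, which
    -- `large` makes smaller.
    net : Σ[ x ∈ Vec Y M ] Covers x ⊎ Σ[ e ∈ Vec Y d ] Realised e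
    net with all-or (λ x → map₂ (x ,_) (covers-or-misses x)) (vecs ys M) | all-or bad-rare (vecs ys (M * 2))
    ... | inj₂ c | _ = inj₁ c
    ... | inj₁ _ | inj₂ s = inj₂ s
    ... | inj₁ missed | inj₁ rare = ⊥-elim (<⇒≱ large (*-cancelˡ-≤ (W * W * 2 ^ M) {{nz}} (begin
      W * W * 2 ^ M * 2 ^ R                  ≡⟨ arrange₁ (W * W) (2 ^ M) (2 ^ R) ⟩
      2 ^ R * (2 ^ M * (W * W))              ≤⟨ *-monoʳ-≤ (2 ^ R) (*-monoʳ-≤ (2 ^ M) lower) ⟩
      2 ^ R * (2 ^ M * (2 * Q * B))          ≡⟨ arrange₂ (2 ^ R) (2 ^ M) (2 * Q) B ⟩
      2 * Q * (2 ^ R * (2 ^ M * B))          ≤⟨ *-monoʳ-≤ (2 * Q) upper ⟩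
      2 * Q * (W * W * (S * 2 ^ M))          ≡⟨ arrange₃ (2 * Q) (W * W) S (2 ^ M) ⟩
      W * W * 2 ^ M * (2 * Q * S)            ∎)))
      where
      open ≤-Reasoning
      W = T# ^ M
      S = suc (M * 2) ^ d
      B = ∑ (vecs ys (M * 2)) bad
      instance
        W≢0 : NonZero W
        W≢0 = m^n≢0 T# M {{>-nonZero 0<T}}
      nz : NonZero (W * W * 2 ^ M)
      nz = m*n≢0 (W * W) (2 ^ M) {{m*n≢0 W W}} {{m^n≢0 2 M}}
      arrange₁ : ∀ a b c → a * b * c ≡ c * (b * a)
      arrange₁ = solve-∀
      arrange₂ : ∀ a b c d → a * (b * (c * d)) ≡ c * (a * (b * d))
      arrange₂ = solve-∀
      arrange₃ : ∀ a b c d → a * (b * (c * d)) ≡ b * d * (a * c)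
      arrange₃ = solve-∀
      lower : W * W ≤ 2 * Q * B
      lower = begin
        W * W                                       ≡⟨ cong (_* W) (sym (length-vecs ys M)) ⟩
        length (vecs ys M) * W                      ≡⟨ sym (∑-const (vecs ys M) W) ⟩
        ∑ (vecs ys M) (λ _ → W)                     ≤⟨ ∑-mono-All (vecs ys M) (All.map (λ {x} → bad-frequent x) missed) ⟩
        ∑ (vecs ys M) (λ x → 2 * Q * ∑ (vecs ys M) (λ y → bad (interleave x y))) ≡⟨ sym (*-distribˡ-∑ (2 * Q) (vecs ys M) _) ⟩
        2 * Q * ∑ (vecs ys M) (λ x → ∑ (vecs ys M) (λ y → bad (interleave x y))) ≡⟨ cong (2 * Q *_) (sym (∑-interleave ys M bad)) ⟩
        2 * Q * B                                   ∎
      -- No swap pattern changes the distribution of `z`, so the swaps may be averaged first, with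
      -- `z` fixed.
      symmetrise : 2 ^ M * B ≡ ∑ (vecs ys (M * 2)) (λ z → ∑ (vecs bools M) (λ σ → bad (swaps σ z)))
      symmetrise = begin-equality
        2 ^ M * B                                                             ≡⟨ cong (_* B) (sym (length-vecs bools M)) ⟩
        length (vecs bools M) * B                                             ≡⟨ sym (∑-const (vecs bools M) B) ⟩
        ∑ (vecs bools M) (λ _ → B)                                            ≡⟨ ∑-cong (vecs bools M) (λ σ → sym (∑-swaps ys σ bad)) ⟩
        ∑ (vecs bools M) (λ σ → ∑ (vecs ys (M * 2)) (λ z → bad (swaps σ z)))  ≡⟨ ∑-swap (vecs bools M) (vecs ys (M * 2)) _ ⟩
        ∑ (vecs ys (M * 2)) (λ z → ∑ (vecs bools M) (λ σ → bad (swaps σ z)))  ∎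
      upper : 2 ^ R * (2 ^ M * B) ≤ W * W * (S * 2 ^ M)
      upper = begin
        2 ^ R * (2 ^ M * B)                                                                ≡⟨ cong (2 ^ R *_) symmetrise ⟩
        2 ^ R * ∑ (vecs ys (M * 2)) (λ z → ∑ (vecs bools M) (λ σ → bad (swaps σ z)))       ≡⟨ *-distribˡ-∑ (2 ^ R) (vecs ys (M * 2)) _ ⟩
        ∑ (vecs ys (M * 2)) (λ z → 2 ^ R * ∑ (vecs bools M) (λ σ → bad (swaps σ z)))       ≤⟨ ∑-mono-All (vecs ys (M * 2)) rare ⟩
        ∑ (vecs ys (M * 2)) (λ _ → S * 2 ^ M)                                              ≡⟨ ∑-const (vecs ys (M * 2)) _ ⟩
        length (vecs ys (M * 2)) * (S * 2 ^ M)                                             ≡⟨ cong (_* (S * 2 ^ M)) (length-vecs ys (M * 2)) ⟩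
        T# ^ (M * 2) * (S * 2 ^ M)                                                         ≡⟨ cong (_* (S * 2 ^ M)) (trans (sym (^-*-assoc T# M 2)) (cong (W *_) (*-identityʳ W))) ⟩
        W * W * (S * 2 ^ M)                                                                ∎

-- From nets to covers of bounded size

exponential-beats-polynomial : ∀ A B d → ∃[ R ] (0 < R × A * suc (B * R) ^ d < 2 ^ R)
exponential-beats-polynomial A B d = 2 ^ s , m^n>0 2 s , (begin-strict
  A * suc (B * 2 ^ s) ^ d            ≤⟨ *-mono-≤ (<⇒≤ (n<2^n A)) (^-monoˡ-≤ d base) ⟩
  2 ^ A * (2 ^ (1 + B + s)) ^ d      ≡⟨ cong (2 ^ A *_) (^-*-assoc 2 (1 + B + s) d) ⟩
  2 ^ A * 2 ^ ((1 + B + s) * d)      ≡⟨ sym (^-distribˡ-+-* 2 A _) ⟩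
  2 ^ (A + (1 + B + s) * d)          <⟨ ^-monoʳ-< 2 (s≤s (s≤s z≤n)) exponent ⟩
  2 ^ (2 ^ s)                        ∎)
  where
  open ≤-Reasoning
  -- With `R = 2 ^ s` both sides are compared as powers of two. The left exponent is linear in `s`;
  -- for `s = 2r` this `r` makes it at most `r + r * r`, which is below
  -- `(r + 1) * (r + 1) ≤ 2 ^ (2r)`.
  r = A + (3 + B) * d
  s = r + r
  base : suc (B * 2 ^ s) ≤ 2 ^ (1 + B + s)
  base = begin
    1 + B * 2 ^ s                     ≤⟨ +-mono-≤ (m^n>0 2 (B + s)) (*-monoˡ-≤ (2 ^ s) (<⇒≤ (n<2^n B))) ⟩
    2 ^ (B + s) + 2 ^ B * 2 ^ s       ≡⟨ cong (2 ^ (B + s) +_) (trans (sym (^-distribˡ-+-* 2 B s)) (sym (+-identityʳ _))) ⟩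
    2 ^ (1 + B + s)                   ∎
  exponent : A + (1 + B + s) * d < 2 ^ s
  exponent = begin-strict
    A + (1 + B + (r + r)) * d                   ≤⟨ m≤m+n _ _ ⟩
    A + (1 + B + (r + r)) * d + (2 * d + r * (A + (1 + B) * d))   ≡⟨ expand A B d ⟩
    r + r * r                                   <⟨ m≤m+n _ r ⟩
    suc (r + r * r) + r                         ≡⟨ square r ⟩
    suc r * suc r                               ≤⟨ *-mono-≤ (n<2^n r) (n<2^n r) ⟩
    2 ^ r * 2 ^ r                               ≡⟨ sym (^-distribˡ-+-* 2 r r) ⟩
    2 ^ s                                       ∎
    where
    square : ∀ r → suc (r + r * r) + r ≡ suc r * suc r
    square = solve-∀
    expand : ∀ A B d → let r = A + (3 + B) * d in
      A + (1 + B + (r + r)) * d + (2 * d + r * (A + (1 + B) * d)) ≡ r + r * r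
    expand = solve-∀

module _ {a} (hit : Fin a → Y → Bool) (F : Fin a → Fin a → Y) (m : ℕ) where

  -- The `m * m` columns are indexed by pairs, and row `l` realises the pattern that selects the
  -- pairs containing `l`.
  shattered⇒scattered : (e : Vec Y (m * m)) → (∀ p → ∃[ v ] Vec.map (hit v) e ≡ p) → Scattered hit F m
  shattered⇒scattered e realise = record
    { row = row ; column = λ i j → lookup e (combine i j)
    ; avoid = λ i j l i≢l j≢l → trans (hit-row i j l)
        (cong₂ _∨_ (dec-false (l ≟ i) (i≢l ∘ sym)) (dec-false (l ≟ j) (j≢l ∘ sym)))
    ; source = λ i j → trans (hit-row i j i) (cong (_∨ does (i ≟ j)) (dec-true (i ≟ i) refl))
    ; target = λ i j → inj₂ (trans (hit-row i j j) (trans (cong (does (j ≟ i) ∨_) (dec-true (j ≟ j) refl)) (∨-zeroʳ _)))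
    }
    where
    meets : Fin m → Fin m × Fin m → Bool
    meets l (i , j) = does (l ≟ i) ∨ does (l ≟ j)
    pattern′ : Fin m → Vec Bool (m * m)
    pattern′ l = Vec.tabulate (meets l ∘ remQuot m)
    row : Fin m → Fin a
    row l = proj₁ (realise (pattern′ l))
    hit-row : ∀ i j l → hit (row l) (lookup e (combine i j)) ≡ meets l (i , j)
    hit-row i j l = begin
      hit (row l) (lookup e (combine i j))           ≡⟨ sym (lookup-map (combine i j) (hit (row l)) e) ⟩
      lookup (Vec.map (hit (row l)) e) (combine i j) ≡⟨ cong (λ p → lookup p (combine i j)) (proj₂ (realise (pattern′ l))) ⟩
      lookup (pattern′ l) (combine i j)              ≡⟨ lookup∘tabulate _ (combine i j) ⟩
      meets l (remQuot m (combine i j))              ≡⟨ cong (meets l) (remQuot-combine i j) ⟩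
      meets l (i , j)                                ∎
      where open ≡-Reasoning

-- `c` is fixed before `Y`, the number of rows and `hit`: this is where uniformity in the graph is
-- recorded.
CoverOrScattered : ℕ → ℕ → Set₁
CoverOrScattered m c = ∀ {Y : Set} {a} (hit : Fin a → Y → Bool) (F : Fin a → Fin a → Y) →
  (∀ x y → hit x (F x y) ≡ true) →
  ∃[ ys ] (length ys ≤ c × ∀ v → Any (λ y → hit v y ≡ true) ys) ⊎ Scattered hit F m

cover-or-scattered : ∀ m → ∃[ c ] CoverOrScattered m c
cover-or-scattered m =
  -- `q` exceeds the `m³` triples of the sampling step. The net for fraction `1/(4q)` has
  -- `2 * (4 * q) * R` columns, and double sampling looks at twice as many, hence the coefficient
  -- `4 * (4 * q)`.
  let q = suc (m * (m * m))
      R , 0<R , large = exponential-beats-polynomial (2 * (4 * q)) (4 * (4 * q)) (m * m)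
  in 2 * (4 * q) * R , λ hit F F-source → solution q ≤-refl R 0<R large hit F F-source
  where
  solution : ∀ q → m * (m * m) < q → ∀ R → 0 < R → 2 * (4 * q) * suc (4 * (4 * q) * R) ^ (m * m) < 2 ^ R →
    CoverOrScattered m (2 * (4 * q) * R)
  solution q m³<q R 0<R large {a = zero} hit F F-source = inj₁ ([] , z≤n , λ ())
  solution q m³<q R 0<R large {a = suc _} hit F F-source with fractional-cover hit F F-source (s≤s z≤n) m q m³<q
  ... | inj₂ s = inj₂ s
  ... | inj₁ (ys , 0<T , heavy)
    with Net.net hit ys 0<T (4 * q) (≤-trans (≤-trans (s≤s z≤n) m³<q) (m≤m+n q _)) heavy (m * m) R 0<R
           (subst (λ k → 2 * (4 * q) * suc k ^ (m * m) < 2 ^ R) (reorder (4 * q) R) large)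
    where
    reorder : ∀ Q R → 4 * Q * R ≡ (2 * Q * R) * 2
    reorder = solve-∀
  ...   | inj₁ (x , covers)  = inj₁ (Vec.toList x , ≤-reflexive (length-toList x) , λ v →
            List.lose (∈-toList⁺ (∈-lookupᵛ (proj₁ (covers v)) x)) (proj₂ (covers v)))
  ...   | inj₂ (e , realise) = inj₂ (shattered⇒scattered hit F m e realise)

-- Ramsey

ramseyNumber : ℕ → ℕ → ℕ
ramseyNumber zero    b       = 0
ramseyNumber (suc a) zero    = 0
ramseyNumber (suc a) (suc b) = suc (ramseyNumber a (suc b) + ramseyNumber (suc a) b)

length-filter-¬ : ∀ {P : X → Set} (P? : ∀ x → Dec (P x)) xs →
  length (filter P? xs) + length (filter (¬? ∘ P?) xs) ≡ length xs
length-filter-¬ P? []       = refl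
length-filter-¬ P? (x ∷ xs) with P? x
... | yes _ = cong suc (length-filter-¬ P? xs)
... | no _  = trans (+-suc _ _) (cong suc (length-filter-¬ P? xs))

Homogeneous : (X → X → Set) → List X → Set
Homogeneous R = AllPairs (λ x y → x ≢ y × R x y)

ramsey : ∀ {R : X → X → Set} (R? : ∀ x y → Dec (R x y)) a b xs → AllPairs _≢_ xs → ramseyNumber a b ≤ length xs →
  (∃[ ys ] (ys ⊑ˢ xs × length ys ≡ a × Homogeneous R ys)) ⊎
  (∃[ ys ] (ys ⊑ˢ xs × length ys ≡ b × Homogeneous (λ x y → ¬ R x y) ys))
ramsey R? zero    b       xs _ _ = inj₁ ([] , minimum xs , refl , [])
ramsey R? (suc a) zero    xs _ _ = inj₂ ([] , minimum xs , refl , [])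
ramsey {X} {R} R? (suc a) (suc b) (x ∷ xs) (x∉ ∷ uniq) (s≤s large)
  with ramseyNumber a (suc b) ≤? length (filter (R? x) xs)
... | yes enough = grow (ramsey R? a (suc b) near (AllPairs.filter⁺ (R? x) uniq) enough)
  where
  near = filter (R? x) xs
  grow : (∃[ ys ] (ys ⊑ˢ near × length ys ≡ a × Homogeneous R ys)) ⊎
         (∃[ ys ] (ys ⊑ˢ near × length ys ≡ suc b × Homogeneous (λ x y → ¬ R x y) ys)) → _
  grow (inj₁ (ys , sub , len , hom)) = inj₁ (x ∷ ys , refl ∷ˢ ⊆-trans sub (filter-⊆ (R? x) xs) , cong suc len ,
    All.zip (All-resp-⊆ (⊆-trans sub (filter-⊆ (R? x) xs)) x∉ , All-resp-⊆ sub (all-filter (R? x) xs)) ∷ hom)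
  grow (inj₂ (ys , sub , rest)) = inj₂ (ys , x ∷ʳˢ ⊆-trans sub (filter-⊆ (R? x) xs) , rest)
... | no few = grow (ramsey R? (suc a) b far (AllPairs.filter⁺ (¬? ∘ R? x) uniq) enough)
  where
  far = filter (¬? ∘ R? x) xs
  enough : ramseyNumber (suc a) b ≤ length far
  enough = +-cancelˡ-≤ (length (filter (R? x) xs)) _ _ (≤-trans (+-monoˡ-≤ _ (<⇒≤ (≰⇒> few)))
    (≤-trans large (≤-reflexive (sym (length-filter-¬ (R? x) xs)))))
  grow : (∃[ ys ] (ys ⊑ˢ far × length ys ≡ suc a × Homogeneous R ys)) ⊎
         (∃[ ys ] (ys ⊑ˢ far × length ys ≡ b × Homogeneous (λ x y → ¬ R x y) ys)) → _
  grow (inj₁ (ys , sub , rest)) = inj₁ (ys , x ∷ʳˢ ⊆-trans sub (filter-⊆ (¬? ∘ R? x) xs) , rest)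
  grow (inj₂ (ys , sub , len , hom)) = inj₂ (x ∷ ys , refl ∷ˢ ⊆-trans sub (filter-⊆ (¬? ∘ R? x) xs) , cong suc len ,
    All.zip (All-resp-⊆ (⊆-trans sub (filter-⊆ (¬? ∘ R? x) xs)) x∉ , All-resp-⊆ sub (all-filter (¬? ∘ R? x) xs)) ∷ hom)

AllPairs-lookup : ∀ {R : X → X → Set} → (∀ {x y} → R x y → R y x) → ∀ {xs} → AllPairs R xs →
  ∀ i j → i ≢ j → R (List.lookup xs i) (List.lookup xs j)
AllPairs-lookup s (r ∷ rs) zero    zero    i≢j = ⊥-elim (i≢j refl)
AllPairs-lookup s (r ∷ rs) zero    (suc j) i≢j = All.lookup r (∈-lookup j)
AllPairs-lookup s (r ∷ rs) (suc i) zero    i≢j = s (All.lookup r (∈-lookup i))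
AllPairs-lookup s (r ∷ rs) (suc i) (suc j) i≢j = AllPairs-lookup s rs i j (i≢j ∘ cong suc)

AllPairs-index : ∀ {R : X → X → Set} → (∀ {x y} → R x y → R y x) → ∀ {xs a} → length xs ≡ a → AllPairs R xs →
  Σ[ s ∈ (Fin a → X) ] (∀ i j → i ≢ j → R (s i) (s j))
AllPairs-index sy {xs} refl rs = List.lookup xs , AllPairs-lookup sy rs

-- Ramsey is applied to positions and not to the points `f i`, because the columns of a scattered
-- family are indexed by pairs of positions.
ramsey-Fin : ∀ {R : X → X → Set} → (∀ x y → Dec (R x y)) → (∀ {x y} → R x y → R y x) →
  ∀ a b (f : Fin (ramseyNumber a b) → X) →
  (Σ[ s ∈ (Fin a → Fin (ramseyNumber a b)) ] (∀ i j → i ≢ j → s i ≢ s j × R (f (s i)) (f (s j)))) ⊎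
  (Σ[ s ∈ (Fin b → Fin (ramseyNumber a b)) ] (∀ i j → i ≢ j → s i ≢ s j × ¬ R (f (s i)) (f (s j))))
ramsey-Fin R? sy a b f
  with ramsey (λ i j → R? (f i) (f j)) a b (allFin _) (allFin⁺ _) (≤-reflexive (sym (length-tabulate id)))
... | inj₁ (ys , _ , len , hom) = inj₁ (AllPairs-index (λ (d , r) → d ∘ sym , sy r) len hom)
... | inj₂ (ys , _ , len , hom) = inj₂ (AllPairs-index (λ (d , r) → d ∘ sym , r ∘ sy) len hom)

-- Cliques

image : ∀ {n a} → (Fin a → Fin n) → Subset n
image {a = zero}  f = ⊥
image {a = suc a} f = ⁅ f zero ⁆ ∪ image (f ∘ suc)

∈-image⁻ : ∀ {n a} (f : Fin a → Fin n) {x} → x ∈ image f → ∃[ i ] x ≡ f i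
∈-image⁻ {a = zero}  f x∈ = ⊥-elim (∉⊥ x∈)
∈-image⁻ {a = suc a} f x∈ with x∈p∪q⁻ ⁅ f zero ⁆ _ x∈
... | inj₁ h = zero , x∈⁅y⁆⇒x≡y _ h
... | inj₂ h = let i , e = ∈-image⁻ (f ∘ suc) h in suc i , e

x∉p⇒∣p∣<∣⁅x⁆∪p∣ : ∀ {n} {x : Fin n} {p} → x ∉ p → ∣ p ∣ < ∣ ⁅ x ⁆ ∪ p ∣
x∉p⇒∣p∣<∣⁅x⁆∪p∣ {x = x} {p} x∉p = p⊂q⇒∣p∣<∣q∣ (q⊆p∪q ⁅ x ⁆ p , x , x∈p∪q⁺ (inj₁ (x∈⁅x⁆ x)) , x∉p)

a≤∣image∣ : ∀ {n a} (f : Fin a → Fin n) → (∀ i j → i ≢ j → f i ≢ f j) → a ≤ ∣ image f ∣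
a≤∣image∣ {a = zero}  f inj = z≤n
a≤∣image∣ {a = suc a} f inj = ≤-trans (s≤s (a≤∣image∣ (f ∘ suc) λ i j i≢j → inj (suc i) (suc j) λ { refl → i≢j refl }))
  (x∉p⇒∣p∣<∣⁅x⁆∪p∣ λ h → let i , e = ∈-image⁻ (f ∘ suc) h in inj zero (suc i) (λ ()) e)

clique≤ω : ∀ {n a} (G : Graph n) (f : Fin a → Fin n) → (∀ i j → i ≢ j → f i ≢ f j × Adj G (f i) (f j)) → a ≤ ω G
clique≤ω {a = a} G f clique = ≤-trans (a≤∣image∣ f λ i j → proj₁ ∘ clique i j)
  (proj₂ (proj₂ (largestClique G)) (image f) isClique)
  where
  isClique : IsClique G (image f)
  isClique u v u∈ v∈ u≢v with ∈-image⁻ f u∈ | ∈-image⁻ f v∈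
  ... | i , refl | j , refl = proj₂ (clique i j (u≢v ∘ cong f))

-- Induced paths, given by the first vertex, the last vertex and the list of
-- all vertices after the first.

data InducedPath {n} (G : Graph n) : Fin n → Fin n → List (Fin n) → Set where
  []   : ∀ {u} → InducedPath G u u []
  edge : ∀ {u v w xs} → Adj G u v → All (λ z → u ≢ z × ¬ Adj G u z) xs →
         InducedPath G v w xs → InducedPath G u w (v ∷ xs)

module _ {n} (G : Graph n) where

  Touches : Fin n → Fin n → Set
  Touches u v = u ≡ v ⊎ Adj G u v

  touches? : ∀ u v → Dec (Touches u v)
  touches? u v = (u ≟ v) ⊎-dec adj? G u v

  -- Shortcut at the last vertex of the path that u touches.
  prepend : ∀ {u v w xs} → InducedPath G v w xs → Any (Touches u) (v ∷ xs) →
    ∃[ ys ] (InducedPath G u w ys × ys ⊑ˢ (v ∷ xs))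
  prepend {u} {v} {w} {xs} p h with Any.any? (touches? u) xs
  prepend {u} {v} {w} (edge _ _ p) h | yes later = let ys , q , sub = prepend p later in ys , q , v ∷ʳˢ sub
  prepend {u} {v} {w} {xs} p (here (inj₁ refl)) | no ¬later = xs , p , v ∷ʳˢ ⊆-refl
  prepend {u} {v} {w} {xs} p (here (inj₂ adj))  | no ¬later =
    v ∷ xs , edge adj (All.map (λ ¬t → ¬t ∘ inj₁ , ¬t ∘ inj₂) (¬Any⇒All¬ xs ¬later)) p , ⊆-refl
  prepend p (there later) | no ¬later = ⊥-elim (¬later later)

  walk⇒inducedPath : ∀ {P : Fin n → Set} {u w} → P u → Star (λ x y → P x × P y × Adj G x y) u w →
    ∃[ xs ] (InducedPath G u w xs × All P (u ∷ xs))
  walk⇒inducedPath Pu ε = [] , [] , Pu ∷ []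
  walk⇒inducedPath Pu ((_ , Pv , adj) ◅ rest) =
    let xs , p , all = walk⇒inducedPath Pv rest
        ys , q , sub = prepend p (here (inj₂ adj))
    in ys , q , Pu ∷ All-resp-⊆ sub all

  -- Levels are a relation, so `Touches` includes equality: two levels of one vertex differ by at
  -- most one. The resulting slack of one is affordable, as a path with `length xs` edges has
  -- `suc (length xs)` vertices.
  inducedPath-level : ∀ {Φ : Fin n → ℕ → Set} → (∀ {x y a b} → Touches x y → Φ x a → Φ y b → b ≤ suc a) →
    ∀ {u w xs a b} → InducedPath G u w xs → All (λ x → ∃[ a ] Φ x a) (u ∷ xs) → Φ u a → Φ w b → b ≤ suc (a + length xs)
  inducedPath-level lip {a = a} [] _ Φu Φw = ≤-trans (lip (inj₁ refl) Φu Φw) (s≤s (m≤m+n a 0))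
  inducedPath-level lip {xs = v ∷ xs} {a} {b} (edge adj _ p) (_ ∷ levels@((c , Φv) ∷ _)) Φu Φw =
    ≤-trans (inducedPath-level lip p levels Φv Φw)
      (s≤s (≤-trans (+-monoˡ-≤ (length xs) (lip (inj₂ adj) Φu Φv)) (≤-reflexive (sym (+-suc a (length xs))))))

  inducedPath-pairs : ∀ {u w xs} → InducedPath G u w xs → let f = List.lookup (u ∷ xs) in
    ∀ i j → toℕ i < toℕ j → f i ≢ f j × (suc (toℕ i) ≡ toℕ j ⇔ Adj G (f i) (f j))
  inducedPath-pairs (edge {v = v} adj far p) zero (suc zero) _ =
    (λ { refl → irrefl G refl adj }) , mk⇔ (λ _ → adj) (λ _ → refl)
  inducedPath-pairs (edge adj far p) zero (suc (suc j)) _ =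
    let d , ¬a = All.lookup far (∈-lookup j) in d , mk⇔ (λ ()) (⊥-elim ∘ ¬a)
  inducedPath-pairs (edge adj far p) (suc i) (suc j) (s≤s lt) =
    let d , e = inducedPath-pairs p i j lt
    in d , mk⇔ (Equivalence.to e ∘ suc-injective) (cong suc ∘ Equivalence.from e)

  inducedPath⇒P⊑ : ∀ {u w xs t} → InducedPath G u w xs → t ≤ suc (length xs) → P t ⊑ G
  inducedPath⇒P⊑ {u} {w} {xs} {t} p t≤ = f , injective , adjacent
    where
    e : Fin t → Fin (suc (length xs))
    e i = inject≤ i t≤
    f : Fin t → Fin n
    f i = List.lookup (u ∷ xs) (e i)
    pairs : ∀ i j → toℕ i < toℕ j → f i ≢ f j × (suc (toℕ i) ≡ toℕ j ⇔ Adj G (f i) (f j))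
    pairs i j lt with inducedPath-pairs p (e i) (e j)
    ... | h rewrite toℕ-inject≤ i t≤ | toℕ-inject≤ j t≤ = h lt
    injective : ∀ {i j} → f i ≡ f j → i ≡ j
    injective {i} {j} eq with <-cmp (toℕ i) (toℕ j)
    ... | tri< lt _ _ = ⊥-elim (proj₁ (pairs i j lt) eq)
    ... | tri≈ _ e _  = toℕ-injective e
    ... | tri> _ _ gt = ⊥-elim (proj₁ (pairs j i gt) (sym eq))
    adjacent : ∀ i j → Adj (P t) i j ⇔ Adj G (f i) (f j)
    adjacent i j with <-cmp (toℕ i) (toℕ j)
    ... | tri< lt _ _ = mk⇔ [ Equivalence.to (proj₂ (pairs i j lt)) , (λ s → ⊥-elim (<-asym lt (≤-reflexive s))) ]
                            (inj₁ ∘ Equivalence.from (proj₂ (pairs i j lt)))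
    ... | tri> _ _ gt = mk⇔ [ (λ s → ⊥-elim (<-asym gt (≤-reflexive s))) , symm G ∘ Equivalence.to (proj₂ (pairs j i gt)) ]
                            (inj₂ ∘ Equivalence.from (proj₂ (pairs j i gt)) ∘ symm G)
    ... | tri≈ _ e _ with toℕ-injective e
    ...   | refl = mk⇔ (λ a → ⊥-elim (irrefl (P t) refl a)) (λ a → ⊥-elim (irrefl G refl a))

  walk-level⇒P⊑ : ∀ {Φ : Fin n → ℕ → Set} → (∀ {x y a b} → Touches x y → Φ x a → Φ y b → b ≤ suc a) →
    ∀ {u w t} → Φ u 0 → Φ w t → Star (λ x y → (∃[ a ] Φ x a) × (∃[ a ] Φ y a) × Adj G x y) u w → P t ⊑ G
  walk-level⇒P⊑ lip Φu Φw walk =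
    let xs , p , levels = walk⇒inducedPath (_ , Φu) walk
    in inducedPath⇒P⊑ p (inducedPath-level lip p levels Φu Φw)

-- Components

module _ {n} (G : Graph n) where

  N? : ∀ D u → Dec (N G D u)
  N? D u = ¬? (u ∈? D) ×-dec any? λ v → (v ∈? D) ×-dec adj? G v u

module Components {n} (G : Graph n) (Ω : Subset n) where

  Walk : Fin n → Fin n → Set
  Walk = Walk-avoiding G Ω

  reverseWalk : ∀ {x y} → Walk x y → Walk y x
  reverseWalk = Star.reverse (λ (a , b , c) → b , a , symm G c)

  step : ∀ {x y} → x ∉ Ω → y ∉ Ω → Adj G x y → Walk x y
  step x∉ y∉ a = (x∉ , y∉ , a) ◅ ε

  module _ {x : Fin n} (x∉Ω : x ∉ Ω) where

    -- `k` is fuel: it bounds the number of vertices still outside `S`, and each round adds one.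
    saturate : ∀ k S → n ≤ ∣ S ∣ + k → x ∈ S → (∀ y → y ∈ S → Walk x y) →
      ∃[ D ] (∀ y → y ∈ D ⇔ Walk x y)
    saturate k S large x∈S sound
      with any? (λ u → any? (λ v → (u ∈? S) ×-dec ¬? (v ∈? S) ×-dec ¬? (u ∈? Ω) ×-dec ¬? (v ∈? Ω) ×-dec adj? G u v))
    ... | no closed = S , λ y → mk⇔ (sound y) (complete x∈S)
      where
      complete : ∀ {u y} → u ∈ S → Walk u y → y ∈ S
      complete u∈S ε = u∈S
      complete {u} u∈S (_◅_ {j = v} (u∉Ω , v∉Ω , adj) w) with v ∈? S
      ... | yes v∈S = complete v∈S w
      ... | no v∉S  = ⊥-elim (closed (u , v , u∈S , v∉S , u∉Ω , v∉Ω , adj))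
    saturate zero S large x∈S sound | yes (u , v , _ , v∉S , _) =
      ⊥-elim (<⇒≱ (x∉p⇒∣p∣<∣⁅x⁆∪p∣ v∉S) (≤-trans (∣p∣≤n (⁅ v ⁆ ∪ S)) (≤-trans large (≤-reflexive (+-identityʳ _)))))
    saturate (suc k) S large x∈S sound | yes (u , v , u∈S , v∉S , u∉Ω , v∉Ω , adj) =
      saturate k (⁅ v ⁆ ∪ S) (≤-trans large (≤-trans (≤-reflexive (+-suc _ k)) (+-monoˡ-≤ k (x∉p⇒∣p∣<∣⁅x⁆∪p∣ v∉S))))
        (x∈p∪q⁺ (inj₂ x∈S)) λ y → [ (λ h → subst (Walk x) (sym (x∈⁅y⁆⇒x≡y v h)) (sound u u∈S ◅◅ step u∉Ω v∉Ω adj)) , sound y ]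
          ∘ x∈p∪q⁻ ⁅ v ⁆ S

    reachable : ∃[ D ] (∀ y → y ∈ D ⇔ Walk x y)
    reachable = saturate n ⁅ x ⁆ (m≤n+m n _) (x∈⁅x⁆ x) λ y y∈ → subst (Walk x) (sym (x∈⁅y⁆⇒x≡y x y∈)) ε

  -- Junk value ⊥ for x ∈ Ω.
  componentOf : Fin n → Subset n
  componentOf x with x ∈? Ω
  ... | yes _  = ⊥
  ... | no x∉Ω = proj₁ (reachable x∉Ω)

  componentOf-isComponent : ∀ {x} → x ∉ Ω → IsComponent G Ω (componentOf x)
  componentOf-isComponent {x} x∉Ω with x ∈? Ω
  ... | yes x∈Ω = ⊥-elim (x∉Ω x∈Ω)
  ... | no x∉Ω′ = x , x∉Ω′ , proj₂ (reachable x∉Ω′)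

  x∈componentOf : ∀ {x} → x ∉ Ω → x ∈ componentOf x
  x∈componentOf {x} x∉Ω with x ∈? Ω
  ... | yes x∈Ω = ⊥-elim (x∉Ω x∈Ω)
  ... | no x∉Ω′ = Equivalence.from (proj₂ (reachable x∉Ω′) x) ε

  component-walk : ∀ {D x y} → IsComponent G Ω D → x ∈ D → y ∈ D → Walk x y
  component-walk (r , _ , D⇔) x∈ y∈ = reverseWalk (Equivalence.to (D⇔ _) x∈) ◅◅ Equivalence.to (D⇔ _) y∈

  component-closed : ∀ {D x y} → IsComponent G Ω D → x ∈ D → Walk x y → y ∈ D
  component-closed (r , _ , D⇔) x∈ w = Equivalence.from (D⇔ _) (Equivalence.to (D⇔ _) x∈ ◅◅ w)

  component-avoids : ∀ {D x} → IsComponent G Ω D → x ∈ D → x ∉ Ω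
  component-avoids {x = x} (r , r∉Ω , D⇔) x∈ = end r∉Ω (Equivalence.to (D⇔ x) x∈)
    where
    end : ∀ {u y} → u ∉ Ω → Walk u y → y ∉ Ω
    end u∉ ε = u∉
    end u∉ ((_ , v∉ , _) ◅ w) = end v∉ w

  component-inside : ∀ {D x y} → IsComponent G Ω D → x ∈ D → Walk x y →
    Star (λ u v → u ∈ D × v ∈ D × Adj G u v) x y
  component-inside cD x∈ ε = ε
  component-inside cD x∈ (s@(_ , _ , adj) ◅ w) =
    let v∈ = component-closed cD x∈ (s ◅ ε) in (x∈ , v∈ , adj) ◅ component-inside cD v∈ w

  component-absorbs : ∀ {D x y} → IsComponent G Ω D → x ∈ D → y ∉ Ω → Adj G x y → y ∈ D
  component-absorbs cD x∈ y∉ adj = component-closed cD x∈ (step (component-avoids cD x∈) y∉ adj)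

  component-meets : ∀ {D E x} → IsComponent G Ω D → IsComponent G Ω E → x ∈ D → x ∈ E → D ⊆ E
  component-meets cD cE x∈D x∈E y∈D = component-closed cE x∈E (component-walk cD x∈D y∈D)

  N⊆Ω : ∀ {D u} → IsComponent G Ω D → N G D u → u ∈ Ω
  N⊆Ω {u = u} cD (u∉D , v , v∈D , adj) with u ∈? Ω
  ... | yes u∈Ω = u∈Ω
  ... | no u∉Ω  = ⊥-elim (u∉D (component-absorbs cD v∈D u∉Ω adj))

  -- Number v p and D i by p and i: levels grow by at most one along an edge, so
  -- every walk from v 0 to v t is long, in particular an induced one.
  caterpillar : ∀ {t} (v : Fin (suc t) → Fin n) (D : Fin t → Subset n) →
    (∀ i → IsComponent G Ω (D i)) → (∀ p → v p ∈ Ω) →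
    (∀ p q → p ≢ q → v p ≢ v q × ¬ Adj G (v p) (v q)) →
    (∀ i → N G (D i) (v (inject₁ i))) → (∀ i → N G (D i) (v (suc i))) →
    (∀ i p → N G (D i) (v p) → p ≡ inject₁ i ⊎ p ≡ suc i) →
    P t ⊑ G
  caterpillar {t} v D comp v∈Ω indep left right only =
    walk-level⇒P⊑ G {Φ} lipschitz {v zero} {v (fromℕ t)} (inj₁ (zero , refl , refl)) (inj₁ (fromℕ t , toℕ-fromℕ t , refl))
      (<-weakInduction (λ p → Star Step (v zero) (v p)) ε (λ i w → w ◅◅ hop i) (fromℕ t))
    where
    Φ : Fin n → ℕ → Set
    Φ z a = (∃[ p ] (toℕ p ≡ a × z ≡ v p)) ⊎ (∃[ i ] (toℕ i ≡ a × z ∈ D i))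

    Step : Fin n → Fin n → Set
    Step x y = (∃[ a ] Φ x a) × (∃[ a ] Φ y a) × Adj G x y

    attached : ∀ {z p i} → Touches G (v p) z → z ∈ D i → N G (D i) (v p)
    attached {p = p} (inj₁ refl) z∈ = ⊥-elim (component-avoids (comp _) z∈ (v∈Ω p))
    attached {p = p} (inj₂ adj)  z∈ = (λ vp∈ → component-avoids (comp _) vp∈ (v∈Ω p)) , _ , z∈ , symm G adj

    near : ∀ i p → N G (D i) (v p) → toℕ i ≤ toℕ p × toℕ p ≤ suc (toℕ i)
    near i p h with only i p h
    ... | inj₁ refl = ≤-reflexive (sym (toℕ-inject₁ i)) , ≤-trans (≤-reflexive (toℕ-inject₁ i)) (n≤1+n _)
    ... | inj₂ refl = n≤1+n _ , ≤-refl

    merge : ∀ {x y i} → Touches G x y → x ∈ D i → y ∉ Ω → y ∈ D i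
    merge (inj₁ refl) x∈ _ = x∈
    merge (inj₂ adj)  x∈ y∉ = component-absorbs (comp _) x∈ y∉ adj

    lipschitz : ∀ {x y a b} → Touches G x y → Φ x a → Φ y b → b ≤ suc a
    lipschitz t (inj₁ (p , refl , refl)) (inj₁ (q , refl , refl)) with p ≟ q | t
    ... | yes refl | _        = n≤1+n _
    ... | no p≢q   | inj₁ e   = ⊥-elim (proj₁ (indep p q p≢q) e)
    ... | no p≢q   | inj₂ adj = ⊥-elim (proj₂ (indep p q p≢q) adj)
    lipschitz t (inj₁ (p , refl , refl)) (inj₂ (j , refl , y∈)) =
      ≤-trans (proj₁ (near j p (attached t y∈))) (n≤1+n _)
    lipschitz t (inj₂ (i , refl , x∈)) (inj₁ (q , refl , refl)) =
      proj₂ (near i q (attached ([ inj₁ ∘ sym , inj₂ ∘ symm G ] t) x∈))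
    -- Touching vertices outside `Ω` share a component, so `D j` also sees `v (inject₁ i)`, which
    -- forces `j ≤ i`.
    lipschitz t (inj₂ (i , refl , x∈)) (inj₂ (j , refl , y∈)) =
      ≤-trans (proj₁ (near j (inject₁ i) inDj)) (≤-trans (≤-reflexive (toℕ-inject₁ i)) (n≤1+n _))
      where
      y∉Ω = component-avoids (comp j) y∈
      Di⊆Dj = component-meets (comp i) (comp j) (merge t x∈ y∉Ω) y∈
      inDj : N G (D j) (v (inject₁ i))
      inDj = let _ , z , z∈ , adj = left i in (λ h → component-avoids (comp j) h (v∈Ω _)) , z , Di⊆Dj z∈ , adj

    hop : ∀ i → Star Step (v (inject₁ i)) (v (suc i))
    hop i = (onV (inject₁ i) , inD y∈ , symm G adjy)
      ◅ Star.map (λ (x∈ , x′∈ , adj) → inD x∈ , inD x′∈ , adj)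
          (component-inside (comp i) y∈ (component-walk (comp i) y∈ z∈))
      ◅◅ (inD z∈ , onV (suc i) , adjz) ◅ ε
      where
      y∈   = proj₁ (proj₂ (proj₂ (left i)))
      adjy = proj₂ (proj₂ (proj₂ (left i)))
      z∈   = proj₁ (proj₂ (proj₂ (right i)))
      adjz = proj₂ (proj₂ (proj₂ (right i)))
      inD : ∀ {u} → u ∈ D i → ∃[ a ] Φ u a
      inD u∈ = toℕ i , inj₂ (i , refl , u∈)
      onV : ∀ p → ∃[ a ] Φ (v p) a
      onV p = toℕ p , inj₁ (p , refl , refl)

-- Cycles

module _ {m : ℕ} where

  private
    ℓ = suc m

  -- A discrete intermediate value argument: moving up one index at a time, `P` can be left only
  -- through an index in neither set.
  propagate : ∀ {P Q : Fin ℓ → Set} → (∀ i → Dec (P i)) → (∀ i → Dec (Q i)) →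
    (∀ i j → suc (toℕ i) ≡ toℕ j → P i → ¬ Q j) →
    ∀ d x y → toℕ y ≡ d + toℕ x → P x → (∀ z → toℕ x < toℕ z → toℕ z ≤ toℕ y → ¬ (¬ P z × ¬ Q z)) → P y
  propagate {P} P? Q? sep zero x y e Px _ = subst P (sym (toℕ-injective e)) Px
  propagate {P} {Q} P? Q? sep (suc d) x y e Px inside with P? y | Q? y
  ... | yes Py | _      = Py
  ... | no ¬Py | no ¬Qy = ⊥-elim (inside y (≤-trans (s≤s (m≤n+m (toℕ x) d)) (≤-reflexive (sym e))) ≤-refl (¬Py , ¬Qy))
  ... | no _   | yes Qy = ⊥-elim (sep w y (trans (cong suc toℕw) (sym e)) Pw Qy)
    where
    w< : d + toℕ x < ℓ
    w< = <-trans (≤-reflexive (sym e)) (toℕ<n y)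
    w = fromℕ< w<
    toℕw : toℕ w ≡ d + toℕ x
    toℕw = toℕ-fromℕ< w<
    Pw : P w
    Pw = propagate P? Q? sep d x w toℕw Px λ z lo hi → inside z lo
      (≤-trans hi (≤-trans (≤-reflexive toℕw) (≤-trans (n≤1+n _) (≤-reflexive (sym e)))))

  propagate-≤ : ∀ {P Q : Fin ℓ → Set} → (∀ i → Dec (P i)) → (∀ i → Dec (Q i)) →
    (∀ i j → suc (toℕ i) ≡ toℕ j → P i → ¬ Q j) →
    ∀ x y → toℕ x ≤ toℕ y → P x → (∀ z → toℕ x < toℕ z → toℕ z ≤ toℕ y → ¬ (¬ P z × ¬ Q z)) → P y
  propagate-≤ P? Q? sep x y x≤y = propagate P? Q? sep (toℕ y ℕ.∸ toℕ x) x y (sym (m∸n+n≡m x≤y))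

  Separators : (Fin ℓ → Set) → (Fin ℓ → Set) → 3 ≤ ℓ → Set
  Separators P Q 3≤ℓ = ∃[ i ] ∃[ j ] ((¬ P i × ¬ Q i) × (¬ P j × ¬ Q j) × i ≢ j × ¬ Adj (C ℓ 3≤ℓ) i j)

  -- `p` and `r` cut the cycle into two arcs. Each arc must leave `P` before it enters `Q`, and
  -- interior points of different arcs are neither equal nor adjacent.
  cycle-separation-< : ∀ {P Q : Fin ℓ → Set} → (∀ i → Dec (P i)) → (∀ i → Dec (Q i)) → (∀ i → P i → ¬ Q i) →
    (3≤ℓ : 3 ≤ ℓ) → (∀ i j → Adj (C ℓ 3≤ℓ) i j → P i → ¬ Q j) →
    ∀ p r → P p → Q r → toℕ p < toℕ r → Separators P Q 3≤ℓ
  cycle-separation-< {P} {Q} P? Q? disj 3≤ℓ sep p r Pp Qr p<r = join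
    (any? λ z → (toℕ p <? toℕ z) ×-dec (toℕ z <? toℕ r) ×-dec S? z)
    (any? λ z → ((toℕ z <? toℕ p) ⊎-dec (toℕ r <? toℕ z)) ×-dec S? z)
    where
    S? : ∀ z → Dec (¬ P z × ¬ Q z)
    S? z = ¬? (P? z) ×-dec ¬? (Q? z)
    last = fromℕ m
    sepPQ : ∀ i j → suc (toℕ i) ≡ toℕ j → P i → ¬ Q j
    sepPQ i j e = sep i j (inj₁ (inj₁ e))
    sepQP : ∀ i j → suc (toℕ i) ≡ toℕ j → Q i → ¬ P j
    sepQP i j e Qi Pj = sep j i (inj₂ (inj₁ e)) Pj Qi
    nonadjacent : ∀ i j → toℕ p < toℕ i → toℕ i < toℕ r → toℕ j < toℕ p ⊎ toℕ r < toℕ j →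
      i ≢ j × ¬ Adj (C ℓ 3≤ℓ) i j
    nonadjacent i j p<i i<r (inj₁ j<p) = (λ { refl → <-asym p<i j<p }) ,
      λ { (inj₁ (inj₁ e)) → <-asym (<-trans j<p p<i) (≤-reflexive e)
        ; (inj₁ (inj₂ (e , _))) → <⇒≱ (toℕ<n r) (≤-trans (≤-reflexive (sym e)) i<r)
        ; (inj₂ (inj₁ e)) → <⇒≱ p<i (≤-trans (≤-reflexive (sym e)) j<p)
        ; (inj₂ (inj₂ (_ , e))) → <⇒≱ p<i (≤-trans (≤-reflexive e) z≤n) }
    nonadjacent i j p<i i<r (inj₂ r<j) = (λ { refl → <-asym i<r r<j }) ,
      λ { (inj₁ (inj₁ e)) → <⇒≱ r<j (≤-trans (≤-reflexive (sym e)) i<r)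
        ; (inj₁ (inj₂ (e , _))) → <⇒≱ (toℕ<n r) (≤-trans (≤-reflexive (sym e)) i<r)
        ; (inj₂ (inj₁ e)) → <-asym (<-trans i<r r<j) (≤-reflexive e)
        ; (inj₂ (inj₂ (_ , e))) → <⇒≱ p<i (≤-trans (≤-reflexive e) z≤n) }
    join : Dec (∃[ z ] (toℕ p < toℕ z × toℕ z < toℕ r × ¬ P z × ¬ Q z)) →
           Dec (∃[ z ] ((toℕ z < toℕ p ⊎ toℕ r < toℕ z) × ¬ P z × ¬ Q z)) → Separators P Q 3≤ℓ
    join (yes (i , p<i , i<r , Si)) (yes (j , side , Sj)) = i , j , Si , Sj , nonadjacent i j p<i i<r side
    join (no none) _ = ⊥-elim (disj r (propagate-≤ P? Q? sepPQ p r (<⇒≤ p<r) Pp inside) Qr)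
      where
      inside : ∀ z → toℕ p < toℕ z → toℕ z ≤ toℕ r → ¬ (¬ P z × ¬ Q z)
      inside z p<z z≤r Sz with m≤n⇒m<n∨m≡n z≤r
      ... | inj₁ z<r = none (z , p<z , z<r , Sz)
      ... | inj₂ e   = proj₂ Sz (subst Q (sym (toℕ-injective e)) Qr)
    -- Without a separator on the outer arc, `Q` reaches the last index and `P` reaches index 0, and
    -- these two are adjacent. As `propagate` only runs upwards, `P` at 0 comes from refuting the
    -- alternatives.
    join (yes _) (no none) = ⊥-elim (sep zero last (inj₂ (inj₂ (cong suc (toℕ-fromℕ m) , refl))) Pfirst Qlast)
      where
      Qlast : Q last
      Qlast = propagate-≤ Q? P? sepQP r last (≤-trans (s≤s⁻¹ (toℕ<n r)) (≤-reflexive (sym (toℕ-fromℕ m)))) Qr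
        λ z r<z _ (¬Qz , ¬Pz) → none (z , inj₂ r<z , ¬Pz , ¬Qz)
      Pfirst : P zero
      Pfirst with P? zero | Q? zero
      ... | yes P0 | _     = P0
      ... | no ¬P0 | yes Q0 = ⊥-elim (disj p Pp (propagate-≤ Q? P? sepQP zero p z≤n Q0 inside))
        where
        inside : ∀ z → 0 < toℕ z → toℕ z ≤ toℕ p → ¬ (¬ Q z × ¬ P z)
        inside z _ z≤p (¬Qz , ¬Pz) with m≤n⇒m<n∨m≡n z≤p
        ... | inj₁ z<p = none (z , inj₁ z<p , ¬Pz , ¬Qz)
        ... | inj₂ e   = ¬Pz (subst P (sym (toℕ-injective e)) Pp)
      ... | no ¬P0 | no ¬Q0 with m≤n⇒m<n∨m≡n (z≤n {toℕ p})
      ...   | inj₁ 0<p = ⊥-elim (none (zero , inj₁ 0<p , ¬P0 , ¬Q0))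
      ...   | inj₂ e   = ⊥-elim (¬P0 (subst P (toℕ-injective {j = zero} (sym e)) Pp))

  cycle-separation : ∀ {P Q : Fin ℓ → Set} → (∀ i → Dec (P i)) → (∀ i → Dec (Q i)) → (∀ i → P i → ¬ Q i) →
    (3≤ℓ : 3 ≤ ℓ) → (∀ i j → Adj (C ℓ 3≤ℓ) i j → P i → ¬ Q j) →
    ∀ p r → P p → Q r → Separators P Q 3≤ℓ
  cycle-separation {P} P? Q? disj 3≤ℓ sep p r Pp Qr with <-cmp (toℕ p) (toℕ r)
  ... | tri< lt _ _ = cycle-separation-< P? Q? disj 3≤ℓ sep p r Pp Qr lt
  ... | tri≈ _ e _  = ⊥-elim (disj r (subst P (toℕ-injective e) Pp) Qr)
  ... | tri> _ _ gt = let i , j , Si , Sj , rest = cycle-separation-< Q? P? (λ i Qi Pi → disj i Pi Qi) 3≤ℓ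
                            (λ i j a Qi Pj → sep j i (swap a) Pj Qi) r p Qr Pp gt
                      in i , j , Product.swap Si , Product.swap Sj , rest

-- Potential maximal cliques

module Thinning {n} (G H : Graph n) (chordal : Chordal H) (G⊆H : G ⊆ᴱ H) (Ω : Subset n) (clique : IsClique H Ω)
  (u v : Fin n) (u∈Ω : u ∈ Ω) (v∈Ω : v ∈ Ω) (u≢v : u ≢ v) (¬uv : ¬ Adj G u v) where

  open Components G Ω

  private
    K : Fin n → Subset n
    K = componentOf

    isC : ∀ {x} → x ∉ Ω → IsComponent G Ω (K x)
    isC = componentOf-isComponent

  Closed : Fin n → Fin n → Set
  Closed x z = z ∈ K x ⊎ N G (K x) z

  closed? : ∀ x z → Dec (Closed x z)
  closed? x z = (z ∈? K x) ⊎-dec N? G (K x) z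

  SplitPair : Fin n → Fin n → Set
  SplitPair y z = (y ≡ u × z ≡ v) ⊎ (y ≡ v × z ≡ u)

  -- The edges inside some D ∪ N(D), and those inside Ω other than uv.
  Kept : Fin n → Fin n → Set
  Kept y z = (y ∉ Ω × Closed y z) ⊎ (z ∉ Ω × Closed z y) ⊎ (y ∈ Ω × z ∈ Ω × ¬ SplitPair y z)

  thinned : Graph n
  thinned = record
    { Adj    = λ y z → Adj H y z × Kept y z
    ; adj?   = λ y z → adj? H y z ×-dec
        ((¬? (y ∈? Ω) ×-dec closed? y z) ⊎-dec (¬? (z ∈? Ω) ×-dec closed? z y) ⊎-dec
         ((y ∈? Ω) ×-dec (z ∈? Ω) ×-dec ¬? (((y ≟ u) ×-dec (z ≟ v)) ⊎-dec ((y ≟ v) ×-dec (z ≟ u)))))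
    ; symm   = λ (a , k) → symm H a , flip-kept k
    ; irrefl = λ e (a , _) → irrefl H e a
    }
    where
    flip-pair : ∀ {y z} → SplitPair y z → SplitPair z y
    flip-pair (inj₁ (a , b)) = inj₂ (b , a)
    flip-pair (inj₂ (a , b)) = inj₁ (b , a)
    flip-kept : ∀ {y z} → Kept y z → Kept z y
    flip-kept (inj₁ k)                  = inj₂ (inj₁ k)
    flip-kept (inj₂ (inj₁ k))           = inj₁ k
    flip-kept (inj₂ (inj₂ (a , b , c))) = inj₂ (inj₂ (b , a , c ∘ flip-pair))

  adjacent⇒closed : ∀ {y z} → y ∉ Ω → Adj G y z → Closed y z
  adjacent⇒closed {y} {z} y∉ adj with z ∈? K y
  ... | yes z∈ = inj₁ z∈
  ... | no z∉  = inj₂ (z∉ , y , x∈componentOf y∉ , adj)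

  G⊆thinned : G ⊆ᴱ thinned
  G⊆thinned y z adj = G⊆H y z adj , kept (y ∈? Ω) (z ∈? Ω)
    where
    kept : Dec (y ∈ Ω) → Dec (z ∈ Ω) → Kept y z
    kept (no y∉)  _        = inj₁ (y∉ , adjacent⇒closed y∉ adj)
    kept (yes _)  (no z∉)  = inj₂ (inj₁ (z∉ , adjacent⇒closed z∉ (symm G adj)))
    kept (yes y∈) (yes z∈) = inj₂ (inj₂ (y∈ , z∈ ,
      λ { (inj₁ (refl , refl)) → ¬uv adj ; (inj₂ (refl , refl)) → ¬uv (symm G adj) }))

  thinned⊂H : thinned ⊂ᴱ H
  thinned⊂H = (λ _ _ → proj₁) , u , v , clique u v u∈Ω v∈Ω u≢v ,
    λ { (_ , inj₁ (u∉ , _)) → u∉ u∈Ω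
      ; (_ , inj₂ (inj₁ (v∉ , _))) → v∉ v∈Ω
      ; (_ , inj₂ (inj₂ (_ , _ , ¬split))) → ¬split (inj₁ (refl , refl)) }

  closed-transport : ∀ {x y z} → x ∉ Ω → y ∉ Ω → y ∈ K x → Closed y z → Closed x z
  closed-transport x∉ y∉ y∈ (inj₁ z∈) = inj₁ (component-meets (isC y∉) (isC x∉) (x∈componentOf y∉) y∈ z∈)
  closed-transport {x} {z = z} x∉ y∉ y∈ (inj₂ (z∉ , w , w∈ , adj)) with z ∈? K x
  ... | yes z∈ = inj₁ z∈
  ... | no z∉x = inj₂ (z∉x , w , component-meets (isC y∉) (isC x∉) (x∈componentOf y∉) y∈ w∈ , adj)

  closed-∉Ω : ∀ {x y} → x ∉ Ω → y ∉ Ω → Closed x y → y ∈ K x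
  closed-∉Ω x∉ y∉ (inj₁ y∈) = y∈
  closed-∉Ω x∉ y∉ (inj₂ N)  = ⊥-elim (y∉ (N⊆Ω (isC x∉) N))

  symK : ∀ {x y} → x ∉ Ω → y ∉ Ω → y ∈ K x → x ∈ K y
  symK x∉ y∉ y∈ = component-meets (isC x∉) (isC y∉) y∈ (x∈componentOf y∉) (x∈componentOf x∉)

  thinned-leaves : ∀ {x y z} → x ∉ Ω → y ∈ K x → Adj thinned y z → Closed x z
  thinned-leaves x∉ y∈ (_ , inj₁ (y∉ , c)) = closed-transport x∉ y∉ y∈ c
  -- The edge is kept on account of `z`, which lies outside `Ω` and hence in the component of `y`.
  thinned-leaves x∉ y∈ (_ , inj₂ (inj₁ (z∉ , c))) =
    let y∉ = component-avoids (isC x∉) y∈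
    in closed-transport x∉ y∉ y∈ (inj₁ (symK z∉ y∉ (closed-∉Ω z∉ y∉ c)))
  thinned-leaves x∉ y∈ (_ , inj₂ (inj₂ (y∈Ω , _))) = ⊥-elim (component-avoids (isC x∉) y∈ y∈Ω)

  module _ (unseen : ∀ {x} → x ∉ Ω → N G (K x) u → ¬ N G (K x) v) where

    -- `N(D)` lies in the clique `Ω`, and the only pair split inside `Ω` is `uv`, which by `unseen`
    -- does not lie in `N(D)`.
    boundary-clique : ∀ {x y z} → x ∉ Ω → N G (K x) y → N G (K x) z → y ≢ z → Adj thinned y z
    boundary-clique x∉ Ny Nz y≢z =
      let y∈ = N⊆Ω (isC x∉) Ny ; z∈ = N⊆Ω (isC x∉) Nz
      in clique _ _ y∈ z∈ y≢z , inj₂ (inj₂ (y∈ , z∈ ,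
           λ { (inj₁ (refl , refl)) → unseen x∉ Ny Nz ; (inj₂ (refl , refl)) → unseen x∉ Nz Ny }))

    closed-full : ∀ {x y z} → x ∉ Ω → Closed x y → Closed x z → Adj H y z → Adj thinned y z
    closed-full x∉ (inj₁ y∈) c adj =
      let y∉ = component-avoids (isC x∉) y∈ in adj , inj₁ (y∉ , closed-transport y∉ x∉ (symK x∉ y∉ y∈) c)
    closed-full x∉ (inj₂ N) (inj₁ z∈) adj =
      let z∉ = component-avoids (isC x∉) z∈ in adj , inj₂ (inj₁ (z∉ , closed-transport z∉ x∉ (symK x∉ z∉ z∈) (inj₂ N)))
    closed-full x∉ (inj₂ Ny) (inj₂ Nz) adj = boundary-clique x∉ Ny Nz λ e → irrefl H e adj

    -- A cycle with a vertex in a component `D` either stays in `D ∪ N(D)`, where `thinned` agrees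
    -- with `H`, or leaves it and meets `N(D)` in two non-adjacent vertices, against
    -- `boundary-clique`. The remaining cycles lie inside `Ω`.
    thinned-chordal : Chordal thinned
    thinned-chordal (suc m) 3≤ℓ (f , inj , emb) with any? (λ i → ¬? (f i ∈? Ω))
    ... | yes (p , fp∉) with any? (λ i → ¬? (closed? (f p) (f i)))
    ...   | no ¬leave = chordal (suc m) 3≤ℓ (f , inj , λ i j → mk⇔
              (proj₁ ∘ Equivalence.to (emb i j))
              (Equivalence.from (emb i j) ∘ closed-full fp∉ (within i) (within j)))
      where
      within : ∀ i → Closed (f p) (f i)
      within i with closed? (f p) (f i)
      ... | yes c = c
      ... | no ¬c = ⊥-elim (¬leave (i , ¬c))
    ...   | yes (r , ¬c) = ⊥-elim (collapse
              (cycle-separation (λ i → f i ∈? K (f p)) (λ i → ¬? (closed? (f p) (f i))) (λ i h ¬c → ¬c (inj₁ h)) 3≤ℓ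
                (λ i j a h ¬c → ¬c (thinned-leaves fp∉ h (Equivalence.to (emb i j) a)))
                p r (x∈componentOf fp∉) ¬c))
      where
      boundary : ∀ i → ¬ (f i ∈ K (f p)) → ¬ ¬ Closed (f p) (f i) → N G (K (f p)) (f i)
      boundary i f∉ ¬¬c with closed? (f p) (f i)
      ... | yes (inj₁ f∈) = ⊥-elim (f∉ f∈)
      ... | yes (inj₂ N)  = N
      ... | no ¬c         = ⊥-elim (¬¬c ¬c)
      collapse : ¬ Separators (λ i → f i ∈ K (f p)) (λ i → ¬ Closed (f p) (f i)) 3≤ℓ
      collapse (i , j , (i∉ , ¬¬ci) , (j∉ , ¬¬cj) , i≢j , ¬adj) =
        ¬adj (Equivalence.from (emb i j) (boundary-clique fp∉ (boundary i i∉ ¬¬ci) (boundary j j∉ ¬¬cj) (i≢j ∘ inj)))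
    thinned-chordal (suc zero) (s≤s ()) _ | no _
    thinned-chordal (suc (suc zero)) (s≤s (s≤s ())) _ | no _
    thinned-chordal (suc (suc (suc zero))) 3≤ℓ (f , inj , emb) | no _ = refl
    -- A cycle on at least four vertices has two disjoint non-adjacent pairs, but inside `Ω` only
    -- `u` and `v` are non-adjacent.
    thinned-chordal (suc (suc (suc (suc m)))) 3≤ℓ (f , inj , emb) | no ¬out = ⊥-elim (clash (split i₀ i₂ (λ ()) far₁) (split i₁ i₃ (λ ()) far₂))
      where
      i₀ i₁ i₂ i₃ : Fin (suc (suc (suc (suc m))))
      i₀ = zero
      i₁ = suc zero
      i₂ = suc (suc zero)
      i₃ = suc (suc (suc zero))
      far₁ : ¬ Adj (C _ 3≤ℓ) i₀ i₂
      far₁ (inj₁ (inj₂ (() , _)))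
      far₁ (inj₂ (inj₂ (() , _)))
      far₂ : ¬ Adj (C _ 3≤ℓ) i₁ i₃
      far₂ (inj₁ (inj₂ (() , _)))
      far₂ (inj₂ (inj₂ (_ , ())))
      inΩ : ∀ i → f i ∈ Ω
      inΩ i with f i ∈? Ω
      ... | yes h = h
      ... | no h  = ⊥-elim (¬out (i , h))
      split : ∀ i j → i ≢ j → ¬ Adj (C _ 3≤ℓ) i j → SplitPair (f i) (f j)
      split i j i≢j ¬adj with ((f i ≟ u) ×-dec (f j ≟ v)) ⊎-dec ((f i ≟ v) ×-dec (f j ≟ u))
      ... | yes s = s
      ... | no ¬s = ⊥-elim (¬adj (Equivalence.from (emb i j)
                      (clique _ _ (inΩ i) (inΩ j) (i≢j ∘ inj) , inj₂ (inj₂ (inΩ i , inΩ j , ¬s)))))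
      differ : ∀ {i j x} → i ≢ j → f i ≡ x → ¬ (f j ≡ x)
      differ i≢j a b = i≢j (inj (trans a (sym b)))
      clash : SplitPair (f i₀) (f i₂) → ¬ SplitPair (f i₁) (f i₃)
      clash (inj₁ (a , b)) (inj₁ (c , d)) = differ {i₀} {i₁} (λ ()) a c
      clash (inj₁ (a , b)) (inj₂ (c , d)) = differ {i₀} {i₃} (λ ()) a d
      clash (inj₂ (a , b)) (inj₁ (c , d)) = differ {i₂} {i₁} (λ ()) b c
      clash (inj₂ (a , b)) (inj₂ (c , d)) = differ {i₂} {i₃} (λ ()) b d

module _ {n} (G : Graph n) (Ω : Subset n) where

  open Components G Ω

  PMC-pair : IsPMC G Ω → ∀ u v → u ∈ Ω → v ∈ Ω → u ≢ v → ¬ Adj G u v →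
    ∃[ D ] (IsComponent G Ω D × N G D u × N G D v)
  PMC-pair (H , ((chordal , G⊆H) , minimal) , (clique , _)) u v u∈ v∈ u≢v ¬uv
    with any? (λ x → ¬? (x ∈? Ω) ×-dec N? G (componentOf x) u ×-dec N? G (componentOf x) v)
  ... | yes (x , x∉ , Nu , Nv) = componentOf x , componentOf-isComponent x∉ , Nu , Nv
  ... | no none = ⊥-elim (minimal thinned thinned⊂H
      (thinned-chordal (λ {x} x∉ Nu Nv → none (x , x∉ , Nu , Nv)) , G⊆thinned))
    where open Thinning G H chordal G⊆H Ω clique u v u∈ v∈ u≢v ¬uv

-- Covering a potential maximal clique

does-true⁻ : ∀ {A : Set} (a? : Dec A) → does a? ≡ true → A
does-true⁻ (yes a) _ = a

does-false⁻ : ∀ {A : Set} (a? : Dec A) → does a? ≡ false → ¬ A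
does-false⁻ (no ¬a) _ = ¬a

module Cover {t k c} (coverOrScattered : CoverOrScattered (ramseyNumber (suc k) (suc t)) c) {n} (G : Graph n) (P-free : P t -free G) (ω≤k : ω G ≤ k) (Ω : Subset n) (pmc : IsPMC G Ω)
  (touched : ∀ u → u ∈ Ω → ∃[ D ] (IsComponent G Ω D × N G D u)) where

  open Components G Ω

  Component : Set
  Component = ∃[ D ] IsComponent G Ω D

  -- Equal or adjacent vertices need not share a suitable component from `PMC-pair`; a component
  -- seeing `u` stands in for it, so that `F` is total.
  common : ∀ u v → u ∈ Ω → v ∈ Ω →
    Σ[ K ∈ Component ] (N G (proj₁ K) u × (u ≢ v → ¬ Adj G u v → N G (proj₁ K) v))
  common u v u∈ v∈ with u ≟ v | adj? G u v
  ... | no u≢v | no ¬adj = let D , cD , Nu , Nv = PMC-pair G Ω pmc u v u∈ v∈ u≢v ¬adj in (D , cD) , Nu , λ _ _ → Nv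
  ... | yes e  | _       = let D , cD , Nu = touched u u∈ in (D , cD) , Nu , λ u≢v _ → ⊥-elim (u≢v e)
  ... | no _   | yes adj = let D , cD , Nu = touched u u∈ in (D , cD) , Nu , λ _ ¬adj → ⊥-elim (¬adj adj)

  rows : List (Fin n)
  rows = filter (_∈? Ω) (allFin n)

  vertex : Fin (length rows) → Fin n
  vertex = List.lookup rows

  vertex∈Ω : ∀ i → vertex i ∈ Ω
  vertex∈Ω i = All.lookup (all-filter (_∈? Ω) (allFin n)) (∈-lookup i)

  hit : Fin (length rows) → Component → Bool
  hit i (D , _) = does (N? G D (vertex i))

  hit⁻ : ∀ i K → hit i K ≡ true → N G (proj₁ K) (vertex i)
  hit⁻ i (D , _) = does-true⁻ (N? G D (vertex i))

  miss⁻ : ∀ i K → hit i K ≡ false → ¬ N G (proj₁ K) (vertex i)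
  miss⁻ i (D , _) = does-false⁻ (N? G D (vertex i))

  link : ∀ i j → Σ[ K ∈ Component ] (N G (proj₁ K) (vertex i) ×
    (vertex i ≢ vertex j → ¬ Adj G (vertex i) (vertex j) → N G (proj₁ K) (vertex j)))
  link i j = common (vertex i) (vertex j) (vertex∈Ω i) (vertex∈Ω j)

  F : Fin (length rows) → Fin (length rows) → Component
  F i j = proj₁ (link i j)

  F-source : ∀ i j → hit i (F i j) ≡ true
  F-source i j = dec-true (N? G _ (vertex i)) (proj₁ (proj₂ (link i j)))

  -- A clique of `k + 1` rows exceeds `ω`. An independent set of `t + 1` rows leaves `t` columns
  -- between consecutive rows, which is what `caterpillar` takes.
  not-scattered : ¬ Scattered hit F (ramseyNumber (suc k) (suc t))
  not-scattered scattered = conclude (ramsey-Fin (adj? G) (symm G) (suc k) (suc t) f)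
    where
    open Scattered scattered
    f : Fin (ramseyNumber (suc k) (suc t)) → Fin n
    f = vertex ∘ row
    f-distinct : ∀ i j → i ≢ j → f i ≢ f j
    -- The diagonal column `column i i` tells the two apart: it hits row `i` and avoids row `j`.
    f-distinct i j i≢j e = miss⁻ (row j) (column i i) (avoid i i j i≢j i≢j)
      (subst (N G (proj₁ (column i i))) e (hit⁻ (row i) (column i i) (source i i)))
    f-target : ∀ i j → f i ≢ f j → ¬ Adj G (f i) (f j) → N G (proj₁ (column i j)) (f j)
    f-target i j fi≢fj ¬adj with target i j
    ... | inj₁ e = subst (λ K → N G (proj₁ K) (f j)) (sym e) (proj₂ (proj₂ (link (row i) (row j))) fi≢fj ¬adj)
    ... | inj₂ h = hit⁻ (row j) (column i j) h
    conclude : ¬ ((Σ[ s ∈ (Fin (suc k) → Fin _) ] (∀ i j → i ≢ j → s i ≢ s j × Adj G (f (s i)) (f (s j)))) ⊎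
                  (Σ[ s ∈ (Fin (suc t) → Fin _) ] (∀ i j → i ≢ j → s i ≢ s j × ¬ Adj G (f (s i)) (f (s j)))))
    conclude (inj₁ (s , clique)) = <⇒≱ (clique≤ω G (f ∘ s) λ i j i≢j →
      let d , a = clique i j i≢j in f-distinct (s i) (s j) d , a) ω≤k
    conclude (inj₂ (s , indep)) = P-free (caterpillar (f ∘ s) (proj₁ ∘ K) (proj₂ ∘ K) (λ p → vertex∈Ω _)
      (λ p q p≢q → let d , a = indep p q p≢q in f-distinct (s p) (s q) d , a)
      (λ i → hit⁻ (row (s (inject₁ i))) (K i) (source _ _))
      (λ i → let d , a = indep (inject₁ i) (suc i) (inject₁≢suc i) in f-target _ _ (f-distinct _ _ d) a)
      only)
      where
      K : Fin t → Component
      K i = column (s (inject₁ i)) (s (suc i))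
      inject₁≢suc : ∀ i → inject₁ i ≢ suc i
      inject₁≢suc i e = 1+n≢n (trans (sym (cong toℕ e)) (toℕ-inject₁ i))
      only : ∀ i p → N G (proj₁ (K i)) (f (s p)) → p ≡ inject₁ i ⊎ p ≡ suc i
      only i p Np with p ≟ inject₁ i | p ≟ suc i
      ... | yes e | _     = inj₁ e
      ... | no _  | yes e = inj₂ e
      ... | no a  | no b  = ⊥-elim (miss⁻ (row (s p)) (K i)
              (avoid _ _ (s p) (proj₁ (indep _ p (a ∘ sym))) (proj₁ (indep _ p (b ∘ sym)))) Np)

  cover : ∃[ ys ] (length ys ≤ c ×
                   ∀ i → Any (λ K → hit i K ≡ true) ys)
  cover with coverOrScattered hit F F-source
  ... | inj₁ c = c
  ... | inj₂ s = ⊥-elim (not-scattered s)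

  components-cover : ∃[ 𝒟 ] (All (IsComponent G Ω) 𝒟 ×
    length 𝒟 ≤ c × (_∈ Ω) ≐ ⋃N G 𝒟)
  components-cover = let ys , small , covers = cover in
    List.map proj₁ ys , map⁺ (All.universal proj₂ ys) , ≤-trans (≤-reflexive (length-map proj₁ ys)) small ,
    (λ {u} u∈ → let p = ∈-filter⁺ (_∈? Ω) (∈-allFin u) u∈ in
       subst (⋃N G (List.map proj₁ ys)) (sym (Any.lookup-index p))
         (Any.map⁺ (Any.map (λ {K} → hit⁻ (Any.index p) K) (covers (Any.index p))))) ,
    λ h → inside ys (Any.map⁻ h)
    where
    inside : ∀ ys {u} → Any (λ K → N G (proj₁ K) u) ys → u ∈ Ω
    inside (K ∷ ys) (here h)  = N⊆Ω (proj₂ K) h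
    inside (K ∷ ys) (there h) = inside ys h

lemma1p2 : (t k : ℕ) → ∃[ c ] (∀ (n : ℕ) (G : Graph n) → P t -free G → ω G ≤ k →
    (Ω : Subset n) → IsPMC G Ω →
    (∃[ v ] (v ∈ Ω × (_∈ Ω) ≐ N[ G , v ]))
    ⊎ (∃[ 𝒟 ] (All (IsComponent G Ω) 𝒟 × length 𝒟 ≤ c × (_∈ Ω) ≐ ⋃N G 𝒟)))
lemma1p2 t k = let c , coverOrScattered = cover-or-scattered (ramseyNumber (suc k) (suc t)) in c , bounded coverOrScattered
  where
  bounded : ∀ {c} → CoverOrScattered (ramseyNumber (suc k) (suc t)) c → ∀ n (G : Graph n) → P t -free G → ω G ≤ k →
    (Ω : Subset n) → IsPMC G Ω →
    (∃[ v ] (v ∈ Ω × (_∈ Ω) ≐ N[ G , v ]))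
    ⊎ (∃[ 𝒟 ] (All (IsComponent G Ω) 𝒟 × length 𝒟 ≤ c × (_∈ Ω) ≐ ⋃N G 𝒟))
  bounded coverOrScattered n G P-free ω≤k Ω pmc
    with any? (λ v → (v ∈? Ω) ×-dec all? (λ u → (u ∈? Ω) →-dec ((u ≟ v) ⊎-dec adj? G v u))
                              ×-dec all? (λ u → adj? G v u →-dec (u ∈? Ω)))
  ... | yes (v , v∈ , Ω⊆ , ⊆Ω) = inj₁ (v , v∈ , (λ {u} → Ω⊆ u) , λ { (inj₁ refl) → v∈ ; {u} (inj₂ adj) → ⊆Ω u adj })
  ... | no ¬closed = inj₂ (Cover.components-cover coverOrScattered G P-free ω≤k Ω pmc touched)
    where
    open Components G Ω
    -- A non-neighbour of `u` in `Ω` gives a component by `PMC-pair`, and a neighbour outside `Ω`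
    -- gives its own component. With neither, `Ω` would be `N[u]`.
    touched : ∀ u → u ∈ Ω → ∃[ D ] (IsComponent G Ω D × N G D u)
    touched u u∈ with any? (λ v → (v ∈? Ω) ×-dec ¬? (u ≟ v) ×-dec ¬? (adj? G u v))
    ... | yes (v , v∈ , u≢v , ¬adj) = let D , cD , Nu , _ = PMC-pair G Ω pmc u v u∈ v∈ u≢v ¬adj in D , cD , Nu
    ... | no ¬far with any? (λ v → adj? G u v ×-dec ¬? (v ∈? Ω))
    ...   | yes (v , adj , v∉) = componentOf v , componentOf-isComponent v∉ ,
            (λ h → component-avoids (componentOf-isComponent v∉) h u∈) , v , x∈componentOf v∉ , symm G adj
    ...   | no ¬out = ⊥-elim (¬closed (u , u∈ , near , within))
      where
      near : ∀ v → v ∈ Ω → v ≡ u ⊎ Adj G u v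
      near v v∈ with v ≟ u | adj? G u v
      ... | yes e | _       = inj₁ e
      ... | no _  | yes adj = inj₂ adj
      ... | no d  | no ¬adj = ⊥-elim (¬far (v , v∈ , d ∘ sym , ¬adj))
      within : ∀ v → Adj G u v → v ∈ Ω
      within v adj with v ∈? Ω
      ... | yes v∈ = v∈
      ... | no v∉  = ⊥-elim (¬out (v , adj , v∉))
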